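{- Let $s,t$ be positive integers, let $n_{1}\geq n_{2}\geq \cdots\geq n_s$ and $m_1\geq m_2\geq \cdots\geq m_t$ be odd positive integers, and let $F_1=\bigsqcup_{i=1}^{s}K_{1,n_i}$ and $F_2=\bigsqcup_{j=1}^{t}K_{1,m_j}$. Then $$\hat{r}(F_1,F_2)= \sum_{k=2}^{s+t}l_k,$$ where, for $2\leq k\leq s+t$, $l_k=\max\{n_i+m_j-1 : 1\leq i\leq s,\ 1\leq j\leq t,\ i+j=k\}$.
   Context: All graphs are undirected, simple, finite and without isolated vertices. $K_{1,n}$ is the star with one root vertex joined to $n$ leaves. $\sqcup$ denotes disjoint union of graphs. For graphs $F_1,F_2,G$, write $G\rightarrow(F_1,F_2)$ if for every coloring of the edges of $G$ by red and blue there is either a red copy of $F_1$ or a blue copy of $F_2$ in $G$ (copies are subgraphs, not necessarily induced). The size Ramsey number $\hat{r}(F_1,F_2)$ is the minimum number of edges of a graph $G$ such that $G\rightarrow(F_1,F_2)$. -}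

module Defs where

open import Data.Fin.Base as Fin using (Fin; zero; suc; toℕ; splitAt)
import Data.Fin.Properties as Fin
open import Data.List.Base using (List; []; length; map; filter; cartesianProduct; allFin; applyUpTo)
open import Data.List.Extrema.Nat using (max)
open import Data.Nat.Base using (ℕ; suc; _+_; _∸_; _≤_)
open import Data.Nat.ListAction using (sum)
import Data.Nat.Properties as ℕ
open import Data.Product.Base using (Σ-syntax; ∃-syntax; _×_; _,_)
open import Data.Sum.Base using (_⊎_)
open import Data.Sum.Relation.Binary.Pointwise
  using (Pointwise; ⊎-symmetric; ⊎-irreflexive; ⊎-decidable; ≡⇒Pointwise-≡)
open import Data.Vec.Functional using (foldr)
open import Function.Base using (_on_)
open import Function.Definitions using (Injective)
open import Level using (0ℓ)
open import Relation.Binary.Core using (Rel)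
open import Relation.Binary.Definitions using (Symmetric; Irreflexive; Decidable)
open import Relation.Binary.PropositionalEquality.Core using (_≡_; refl; cong)
open import Relation.Nullary.Decidable using (yes; no; _×-dec_)

record Graph : Set₁ where
  infix 4 _~_ _~?_
  field
    order    : ℕ
    _~_      : Rel (Fin order) 0ℓ
    ~-sym    : Symmetric _~_
    ~-irrefl : Irreflexive _≡_ _~_
    _~?_     : Decidable _~_

  -- Each undirected edge is listed once, with its smaller endpoint first.
  edges : List (Fin order × Fin order)
  edges = filter (λ (u , v) → (u Fin.<? v) ×-dec (u ~? v))
                 (cartesianProduct (allFin order) (allFin order))

  size : ℕ
  size = length edges

NoIsolatedVertices : Graph → Set
NoIsolatedVertices G = ∀ u → ∃[ v ] u ~ v
  where open Graph G

data StarAdj {n : ℕ} : Rel (Fin (suc n)) 0ℓ where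
  root-leaf : ∀ i → StarAdj zero (suc i)
  leaf-root : ∀ i → StarAdj (suc i) zero

K₁,_ : ℕ → Graph
K₁, n = record
  { order    = suc n
  ; _~_      = StarAdj
  ; ~-sym    = λ { (root-leaf i) → leaf-root i ; (leaf-root i) → root-leaf i }
  ; ~-irrefl = λ { refl () }
  ; _~?_     = λ { zero    zero    → no λ ()
                 ; zero    (suc i) → yes (root-leaf i)
                 ; (suc i) zero    → yes (leaf-root i)
                 ; (suc i) (suc j) → no λ () }
  }

emptyGraph : Graph
emptyGraph = record
  { order    = 0
  ; _~_      = λ ()
  ; ~-sym    = λ { {()} }
  ; ~-irrefl = λ { {()} }
  ; _~?_     = λ ()
  }

infixr 5 _⊔_

_⊔_ : Graph → Graph → Graph
G ⊔ H = record
  { order    = G.order + H.order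
  ; _~_      = Pointwise G._~_ H._~_ on splitAt G.order
  ; ~-sym    = ⊎-symmetric G.~-sym H.~-sym
  ; ~-irrefl = λ u≡v → ⊎-irreflexive G.~-irrefl H.~-irrefl
                         (≡⇒Pointwise-≡ (cong (splitAt G.order) u≡v))
  ; _~?_     = λ u v → ⊎-decidable G._~?_ H._~?_ (splitAt G.order u) (splitAt G.order v)
  }
  where
  module G = Graph G
  module H = Graph H

⨆ : ∀ {s} → (Fin s → Graph) → Graph
⨆ = foldr _⊔_ emptyGraph

data Colour : Set where
  red blue : Colour

-- Adjacency is not assumed proof-irrelevant, so `undirected` ranges over all
-- pairs of adjacency proofs: the colour depends only on the set {u , v}.
record EdgeColouring (G : Graph) : Set where
  open Graph G
  field
    colour     : ∀ {u v} → u ~ v → Colour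
    undirected : ∀ {u v} (e : u ~ v) (e′ : v ~ u) → colour e ≡ colour e′

-- A (not necessarily induced) copy of F in G all of whose edges have colour c.
record MonochromaticCopy (F G : Graph) (χ : EdgeColouring G) (c : Colour) : Set where
  private
    module F = Graph F
    module G = Graph G
  open EdgeColouring χ
  field
    embed     : Fin F.order → Fin G.order
    injective : Injective _≡_ _≡_ embed
    edge      : ∀ {u v} → u F.~ v → Σ[ e ∈ embed u G.~ embed v ] colour e ≡ c

infix 4 _⟶⟨_,_⟩

_⟶⟨_,_⟩ : Graph → Graph → Graph → Set
G ⟶⟨ F₁ , F₂ ⟩ = (χ : EdgeColouring G) →
  MonochromaticCopy F₁ G χ red ⊎ MonochromaticCopy F₂ G χ blue

-- "r̂(F₁,F₂) = r", i.e. r is the minimum of size G over the graphs G (without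
-- isolated vertices) with G → (F₁,F₂).
record IsSizeRamseyNumber (F₁ F₂ : Graph) (r : ℕ) : Set₁ where
  field
    attained : Σ[ G ∈ Graph ] NoIsolatedVertices G × (G ⟶⟨ F₁ , F₂ ⟩) × Graph.size G ≡ r
    minimal  : ∀ G → NoIsolatedVertices G → G ⟶⟨ F₁ , F₂ ⟩ → r ≤ Graph.size G

-- With the 1-based indices i = suc (toℕ a) and j = suc (toℕ b), the maximum is
-- over i + j = k.  The default value 0 of `max` matters only when no such pair
-- exists, which does not happen for 2 ≤ k ≤ s + t with s , t ≥ 1.
l : ∀ {s t} → (Fin s → ℕ) → (Fin t → ℕ) → ℕ → ℕ
l {s} {t} n m k =
  max 0 (map (λ (a , b) → n a + m b ∸ 1)
             (filter (λ (a , b) → suc (toℕ a) + suc (toℕ b) ℕ.≟ k)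
                     (cartesianProduct (allFin s) (allFin t))))

-- Σ_{k=2}^{p} f k
sumFrom2To : ℕ → (ℕ → ℕ) → ℕ
sumFrom2To p f = sum (map f (applyUpTo (2 +_) (p ∸ 1)))

{-# OPTIONS --safe #-}
module Submission where

-- Upper bound.  The host graph is the disjoint union of the stars K₁,l_k for
-- 2 ≤ k ≤ s + t.  If a colouring of it has no red F₁, a greedy choice of stars
-- (`distinctRepresentatives`) fails at some i: fewer than i stars have at least
-- n_i red edges.  Likewise, with no blue F₂, fewer than j stars have at least
-- m_j blue edges for some j.  But each of the i + j - 1 stars with k ≤ i + j has
-- at least n_i + m_j - 1 edges, because n and m are antitone, and hence n_i red
-- or m_j blue ones; these are too many (`Upper.arrows`).
--
-- Lower bound.  Let G → (F₁,F₂) and l_k = n_i + m_j - 1 with i + j = k.  After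
-- the deletion of any k - 2 vertices some vertex still has degree at least l_k
-- (`highDegree`), so deleting such vertices one after the other for
-- k = 2, ..., s + t removes at least Σ l_k edges (`peel`).  To prove the degree
-- claim, suppose that all remaining degrees are at most n_i + m_j - 2, and split
-- the deleted vertices into sets X of size i - 1 and Y of size j - 1.  Colour
-- the edges that meet X red, the other edges that meet Y blue, and the remaining
-- edges so that red degrees are at most n_i - 1 and blue degrees at most m_j - 1.
-- Of the first i stars of a red F₁, one avoids X; its edges, being red, avoid Y as
-- well, so its centre is incident with at least n_i red ones among the remaining
-- edges: a contradiction.
-- Blue copies of F₂ are excluded in the same way (`split⇒¬arrow`).
--
-- Since n_i - 1 and m_j - 1 are even, the last colouring is an instance of the
-- following form of Petersen's 2-factor theorem (`twoFactorSplit`): the edges of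
-- a graph with all degrees at most 2(a + b) can be coloured so that red degrees
-- are at most 2a and blue degrees at most 2b.  Orient the edges so that at every
-- vertex the in-degree and the out-degree differ by at most one
-- (`balancedOrientation`); both are then at most a + b.  By König's theorem for
-- the bipartite double, the arcs have a colouring with a + b colours in which no
-- two arcs of the same colour share a source or share a target
-- (`properColouring`); a of the colours become red and b become blue.
--
-- In place of alternating paths, König's theorem uses balanced orientations
-- once more: a new arc with colour α free at its source and β free at its target
-- can be added because the union of the classes α and β with this arc has
-- degrees at most two, so an even split of it consists of two matchings
-- (`balanceClasses`).

open import Defs
open import Data.Bool.Base using (if_then_else_)
open import Data.Fin.Base as Fin using (Fin; zero; suc; toℕ; fromℕ<; splitAt; _↑ˡ_; _↑ʳ_)
import Data.Fin.Properties as Fin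
open import Data.List.Base as List
  using (List; []; _∷_; _++_; map; filter; length; tabulate; allFin; cartesianProduct; applyUpTo)
open import Data.List.Extrema.Nat using (xs≤max; argmax-sel)
open import Data.List.Membership.Propositional using (_∈_)
open import Data.List.Membership.Propositional.Properties
  using (∈-filter⁺; ∈-filter⁻; ∈-map⁺; ∈-map⁻; ∈-cartesianProduct⁺; ∈-allFin; ∈-lookup)
import Data.List.Properties as List
import Data.List.Relation.Unary.All as All
open import Data.List.Relation.Unary.Any using (index)
open import Data.List.Relation.Unary.Any.Properties using (lookup-index)
open import Data.Maybe.Base using (Maybe; just; nothing)
import Data.Maybe.Properties as Maybe
open import Data.Nat.Base
  using (ℕ; zero; suc; _+_; _*_; _∸_; _⊓_; _≤_; _<_; z≤n; s≤s; s≤s⁻¹; NonZero; parity)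
open import Data.Nat.ListAction using () renaming (sum to sumList)
import Data.Nat.Properties as ℕ
open import Algebra.Properties.CommutativeMonoid.Sum ℕ.+-0-commutativeMonoid
  using (sum; sum-cong-≗; ∑-distrib-+; ∑-comm)
open import Data.Nat.Tactic.RingSolver using (solve-∀)
open import Data.Parity.Base using (1ℙ)
open import Data.Product.Base using (Σ-syntax; ∃-syntax; _×_; _,_; proj₁; proj₂; swap)
import Data.Product.Properties as Product
open import Data.Sum.Base as Sum using (_⊎_; inj₁; inj₂; [_,_]′)
open import Data.Sum.Relation.Binary.Pointwise using (Pointwise; inj₁; inj₂)
open import Data.Vec.Functional as Vector using (Vector; updateAt)
open import Data.Vec.Functional.Properties using (updateAt-updates; updateAt-minimal)
open import Function.Base using (_∘_; const; id)
open import Function.Definitions using (Injective)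
open import Relation.Binary.Definitions using (Antitonic₁; DecidableEquality)
open import Relation.Binary.PropositionalEquality
open import Relation.Nullary.Decidable
  using (Dec; yes; no; does; _×-dec_; _⊎-dec_; ¬?; dec-true; dec-false)
open import Relation.Nullary.Negation using (¬_; contradiction)

private variable
  k n s t : ℕ
  A B C   : Set

-- Counting

sum-mono : ∀ {n} {f g : Vector ℕ n} → (∀ i → f i ≤ g i) → sum f ≤ sum g
sum-mono {zero}  f≤g = z≤n
sum-mono {suc n} f≤g = ℕ.+-mono-≤ (f≤g zero) (sum-mono (f≤g ∘ suc))

sum≤n*c : ∀ {n c} {f : Vector ℕ n} → (∀ i → f i ≤ c) → sum f ≤ n * c
sum≤n*c {zero}  f≤c = z≤n
sum≤n*c {suc n} f≤c = ℕ.+-mono-≤ (f≤c zero) (sum≤n*c (f≤c ∘ suc))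

n*c≤sum : ∀ {n c} {f : Vector ℕ n} → (∀ i → c ≤ f i) → n * c ≤ sum f
n*c≤sum {zero}  c≤f = z≤n
n*c≤sum {suc n} c≤f = ℕ.+-mono-≤ (c≤f zero) (n*c≤sum (c≤f ∘ suc))

-- The number 1 or 0 according to whether the decided proposition holds.
ind : Dec A → ℕ
ind a? = if does a? then 1 else 0

ind-yes : (a? : Dec A) → A → ind a? ≡ 1
ind-yes a? a rewrite dec-true a? a = refl

ind-no : (a? : Dec A) → ¬ A → ind a? ≡ 0
ind-no a? ¬a rewrite dec-false a? ¬a = refl

ind≤1 : (a? : Dec A) → ind a? ≤ 1
ind≤1 (yes _) = s≤s z≤n
ind≤1 (no _)  = z≤n

ind-mono : (a? : Dec A) (b? : Dec B) → (A → B) → ind a? ≤ ind b?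
ind-mono (no _)  b? f = z≤n
ind-mono (yes a) b? f = ℕ.≤-reflexive (sym (ind-yes b? (f a)))

ind-cong : (a? : Dec A) (b? : Dec B) → (A → B) → (B → A) → ind a? ≡ ind b?
ind-cong a? b? f g = ℕ.≤-antisym (ind-mono a? b? f) (ind-mono b? a? g)

ind-⊎ : (a? : Dec A) (b? : Dec B) (c? : Dec C) → (C → A ⊎ B) → ind c? ≤ ind a? + ind b?
ind-⊎ a? b? (no _)  f = z≤n
ind-⊎ a? b? (yes c) f with f c
... | inj₁ a rewrite ind-yes a? a = s≤s z≤n
... | inj₂ b rewrite ind-yes b? b = ℕ.m≤n+m 1 _

ind-disjoint : (a? : Dec A) (b? : Dec B) (c? : Dec C) →
               (A → C) → (B → C) → (A → ¬ B) → ind a? + ind b? ≤ ind c?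
ind-disjoint (no _)  b?      c? f g d = ind-mono b? c? g
ind-disjoint (yes a) (no _)  c? f g d = ind-mono (yes a) c? f
ind-disjoint (yes a) (yes b) c? f g d = contradiction b (d a)

-- The number of indices that satisfy a decidable predicate.
count : ∀ {n} {P : Fin n → Set} → (∀ i → Dec (P i)) → ℕ
count P? = sum (λ i → ind (P? i))

count-mono : ∀ {n} {P Q : Fin n → Set} (P? : ∀ i → Dec (P i)) (Q? : ∀ i → Dec (Q i)) →
             (∀ i → P i → Q i) → count P? ≤ count Q?
count-mono P? Q? P⊆Q = sum-mono (λ i → ind-mono (P? i) (Q? i) (P⊆Q i))

count-⊎ : ∀ {n} {P Q R : Fin n → Set}
          (P? : ∀ i → Dec (P i)) (Q? : ∀ i → Dec (Q i)) (R? : ∀ i → Dec (R i)) →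
          (∀ i → R i → P i ⊎ Q i) → count R? ≤ count P? + count Q?
count-⊎ P? Q? R? f = ℕ.≤-trans
  (sum-mono (λ i → ind-⊎ (P? i) (Q? i) (R? i) (f i)))
  (ℕ.≤-reflexive (∑-distrib-+ (ind ∘ P?) (ind ∘ Q?)))

count-disjoint : ∀ {n} {P Q R : Fin n → Set}
                 (P? : ∀ i → Dec (P i)) (Q? : ∀ i → Dec (Q i)) (R? : ∀ i → Dec (R i)) →
                 (∀ i → P i → R i) → (∀ i → Q i → R i) → (∀ i → P i → ¬ Q i) →
                 count P? + count Q? ≤ count R?
count-disjoint P? Q? R? f g d = ℕ.≤-trans
  (ℕ.≤-reflexive (sym (∑-distrib-+ (ind ∘ P?) (ind ∘ Q?))))
  (sum-mono (λ i → ind-disjoint (P? i) (Q? i) (R? i) (f i) (g i) (d i)))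

count-none : ∀ {n} {P : Fin n → Set} (P? : ∀ i → Dec (P i)) → (∀ i → ¬ P i) → count P? ≡ 0
count-none {n = n} P? ¬P = ℕ.n≤0⇒n≡0 (subst (count P? ≤_) (ℕ.*-zeroʳ n)
  (sum≤n*c (λ i → ℕ.≤-reflexive (ind-no (P? i) (¬P i)))))

count-some : ∀ {n} {P : Fin n → Set} (P? : ∀ i → Dec (P i)) → ∀ i → P i → 1 ≤ count P?
count-some P? zero    p rewrite ind-yes (P? zero) p = s≤s z≤n
count-some P? (suc i) p = ℕ.≤-trans (count-some (P? ∘ suc) i p) (ℕ.m≤n+m _ _)

count-unique : ∀ {n} {P : Fin n → Set} (P? : ∀ i → Dec (P i)) →
               (∀ i j → P i → P j → i ≡ j) → count P? ≤ 1
count-unique {zero}  P? u = z≤n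
count-unique {suc n} P? u with P? zero
... | no  _ = count-unique (P? ∘ suc) (λ i j p q → Fin.suc-injective (u _ _ p q))
... | yes p = ℕ.≤-reflexive (cong suc (count-none (P? ∘ suc)
                (λ i q → contradiction (u _ _ p q) λ ())))

-- A predicate covered by k predicates, each with at most c witnesses, has at
-- most k * c witnesses.
count-cover : ∀ {k n} {P : Fin n → Set} (P? : ∀ i → Dec (P i))
              {R : Fin k → Fin n → Set} (R? : ∀ j i → Dec (R j i)) →
              (c : ℕ) → (∀ j → count (R? j) ≤ c) → (∀ i → P i → ∃[ j ] R j i) →
              count P? ≤ k * c
count-cover P? R? c Rc cover = begin
  count P?                                ≤⟨ sum-mono hit ⟩
  sum (λ i → sum (λ j → ind (R? j i)))    ≡⟨ ∑-comm (λ i j → ind (R? j i)) ⟩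
  sum (λ j → count (R? j))                ≤⟨ sum≤n*c Rc ⟩
  _                                       ∎
  where
  open ℕ.≤-Reasoning
  hit : ∀ i → ind (P? i) ≤ sum (λ j → ind (R? j i))
  hit i with P? i
  ... | no _  = z≤n
  ... | yes p with j , r ← cover i p = count-some (λ j → R? j i) j r

injection⇒≤count : ∀ {k n} {P : Fin n → Set} (P? : ∀ i → Dec (P i)) (f : Fin k → Fin n) →
                   Injective _≡_ _≡_ f → (∀ j → P (f j)) → k ≤ count P?
injection⇒≤count {k = k} P? f inj Pf = begin
  k                                          ≡⟨ ℕ.*-identityʳ k ⟨
  k * 1                                      ≤⟨ n*c≤sum (λ j → count-some (λ i → f j Fin.≟ i) (f j) refl) ⟩
  sum (λ j → sum (λ i → ind (f j Fin.≟ i)))  ≡⟨ ∑-comm (λ j i → ind (f j Fin.≟ i)) ⟩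
  sum (λ i → sum (λ j → ind (f j Fin.≟ i)))  ≤⟨ sum-mono fibre ⟩
  count P?                                   ∎
  where
  open ℕ.≤-Reasoning
  fibre : ∀ i → sum (λ j → ind (f j Fin.≟ i)) ≤ ind (P? i)
  fibre i with P? i
  ... | yes _ = count-unique (λ j → f j Fin.≟ i) (λ j j′ p q → inj (trans p (sym q)))
  ... | no ¬p = ℕ.≤-reflexive (count-none (λ j → f j Fin.≟ i) (λ { j refl → ¬p (Pf j) }))

-- The larger of two numbers that differ by at most one is at most half of any
-- even bound for their sum.
half : ∀ {p q} d → p ≤ suc q → p + q ≤ d + d → p ≤ d
half {p} {q} d p≤1+q p+q≤2d with p ℕ.≤? d
... | yes p≤d = p≤d
... | no  p≰d = contradiction (begin-strict
    d + d   <⟨ ℕ.n<1+n _ ⟩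
    suc d + d ≤⟨ ℕ.+-mono-≤ d<p (s≤s⁻¹ (ℕ.≤-trans d<p p≤1+q)) ⟩
    p + q   ≤⟨ p+q≤2d ⟩
    d + d   ∎) (ℕ.<-irrefl refl)
  where
  open ℕ.≤-Reasoning
  d<p = ℕ.≰⇒> p≰d

-- Balanced orientations of multigraphs

sum-updateAt : (f : A → ℕ) (o : Vector A n) (j : Fin n) (y : A) →
               sum (f ∘ updateAt o j (const y)) + f (o j) ≡ sum (f ∘ o) + f y
sum-updateAt f o zero    y = lemma (f y) (sum (f ∘ o ∘ suc)) (f (o zero))
  where
  lemma : ∀ a b c → (a + b) + c ≡ (c + b) + a
  lemma = solve-∀
sum-updateAt f o (suc j) y = trans (ℕ.+-assoc (f (o zero)) _ _)
  (trans (cong (f (o zero) +_) (sum-updateAt f (o ∘ suc) j y))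
         (sym (ℕ.+-assoc (f (o zero)) _ _)))

-- Equality as unordered pairs.
infix 4 _∼_
_∼_ : A × A → A × A → Set
p ∼ q = p ≡ q ⊎ p ≡ swap q

∼-trans : {p q r : A × A} → p ∼ q → q ∼ r → p ∼ r
∼-trans (inj₁ refl) q∼r         = q∼r
∼-trans (inj₂ refl) (inj₁ refl) = inj₂ refl
∼-trans (inj₂ refl) (inj₂ refl) = inj₁ refl

∼-sym : {p q : A × A} → p ∼ q → q ∼ p
∼-sym (inj₁ refl) = inj₁ refl
∼-sym (inj₂ refl) = inj₂ refl

-- The ends of an arc, which is a pair of vertices.
data End : Set where
  source target : End

_≟ᵉ_ : DecidableEquality End
source ≟ᵉ source = yes refl
source ≟ᵉ target = no λ ()
target ≟ᵉ source = no λ ()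
target ≟ᵉ target = yes refl

end : End → A × A → A
end source = proj₁
end target = proj₂

-- The edges of a multigraph form a family of pairs of vertices; loops and
-- repetitions are allowed.  The order within a pair matters only where the pair
-- is regarded as an arc.
module Multigraph {V : Set} (_≟_ : DecidableEquality V) where

  -- The out-degree (at `source`) or the in-degree (at `target`).
  degree : End → Vector (V × V) n → V → ℕ
  degree κ e x = count (λ i → end κ (e i) ≟ x)

  Balanced : Vector (V × V) n → Set
  Balanced o = ∀ x → degree source o x ≤ suc (degree target o x)
                   × degree target o x ≤ suc (degree source o x)

  -- Incidence of a vertex with an edge.
  Touches : V → V × V → Set
  Touches x (u , v) = u ≡ x ⊎ v ≡ x

  touches? : ∀ x p → Dec (Touches x p)
  touches? x (u , v) = (u ≟ x) ⊎-dec (v ≟ x)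

  Touches-resp-∼ : ∀ {p q x} → p ∼ q → Touches x p → Touches x q
  Touches-resp-∼ (inj₁ refl) t = t
  Touches-resp-∼ (inj₂ refl) t = Sum.swap t

  private
    -- The two edges share a vertex.
    Meets : V × V → V × V → Set
    Meets p (v , w) = Touches v p ⊎ Touches w p

    -- Two edges that share a vertex form a walk u, v, w.
    walk : ∀ p q → Meets p q → ∃[ u ] ∃[ v ] ∃[ w ] (u , v) ∼ p × (v , w) ∼ q
    walk (a , b) (c , d) (inj₁ (inj₁ refl)) = b , a , d , inj₂ refl , inj₁ refl
    walk (a , b) (c , d) (inj₁ (inj₂ refl)) = a , b , d , inj₁ refl , inj₁ refl
    walk (a , b) (c , d) (inj₂ (inj₁ refl)) = b , a , c , inj₂ refl , inj₂ refl
    walk (a , b) (c , d) (inj₂ (inj₂ refl)) = a , b , c , inj₁ refl , inj₂ refl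

    -- Replacing the arc from u to w by arcs from u to v and from v to w adds one to
    -- the in-degree and to the out-degree of v and changes no other degree.  The two
    -- parts differ in which of the two new arcs takes the place of the old one.
    subdivide-balanced : (o : Vector (V × V) n) (j : Fin n) {u v w : V} → o j ≡ (u , w) →
                         Balanced o →
                         Balanced ((u , v) Vector.∷ updateAt o j (const (v , w)))
                         × Balanced ((v , w) Vector.∷ updateAt o j (const (u , v)))
    subdivide-balanced o j {u} {v} {w} oj≡ bal = balanced₁ , balanced₂
      where
      keep : (f : V × V → ℕ) (y : V × V) → f (u , w) ≡ f y →
             sum (f ∘ updateAt o j (const y)) ≡ sum (f ∘ o)
      keep f y eq = ℕ.+-cancelʳ-≡ (f y) _ _
        (subst (λ z → sum (f ∘ updateAt o j (const y)) + z ≡ sum (f ∘ o) + f y)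
               (trans (cong f oj≡) eq) (sum-updateAt f o j y))
      change : (f : V × V → ℕ) (y : V × V) →
               f (u , w) + sum (f ∘ updateAt o j (const y)) ≡ f y + sum (f ∘ o)
      change f y = trans (ℕ.+-comm (f (u , w)) _)
        (trans (subst (λ z → sum (f ∘ updateAt o j (const y)) + f z ≡ sum (f ∘ o) + f y)
                      oj≡ (sum-updateAt f o j y))
               (ℕ.+-comm _ (f y)))
      shift : ∀ x {a b} → a ≡ ind (v ≟ x) + degree source o x →
              b ≡ ind (v ≟ x) + degree target o x →
              a ≤ suc b × b ≤ suc a
      shift x refl refl =
        ℕ.≤-trans (ℕ.+-monoʳ-≤ (ind (v ≟ x)) (proj₁ (bal x))) (ℕ.≤-reflexive (ℕ.+-suc _ _)) ,
        ℕ.≤-trans (ℕ.+-monoʳ-≤ (ind (v ≟ x)) (proj₂ (bal x))) (ℕ.≤-reflexive (ℕ.+-suc _ _))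
      at : End → V → V × V → ℕ
      at κ x p = ind (end κ p ≟ x)
      balanced₁ : Balanced ((u , v) Vector.∷ updateAt o j (const (v , w)))
      balanced₁ x = shift x
        (change (at source x) (v , w))
        (cong (ind (v ≟ x) +_) (keep (at target x) (v , w) refl))
      balanced₂ : Balanced ((v , w) Vector.∷ updateAt o j (const (u , v)))
      balanced₂ x = shift x
        (cong (ind (v ≟ x) +_) (keep (at source x) (u , v) refl))
        (change (at target x) (u , v))

  -- By induction on the number of edges.  If the first edge shares a vertex v with
  -- another one, the two are merged into a single edge that bypasses v, and an
  -- orientation of the smaller multigraph is pulled back along the merge.  If it
  -- shares none, its direction is arbitrary.
  balancedOrientation : ∀ n (e : Vector (V × V) n) →
    Σ[ o ∈ Vector (V × V) n ] (∀ i → o i ∼ e i) × Balanced o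
  balancedOrientation zero    e = e , (λ ()) , (λ x → z≤n , z≤n)
  balancedOrientation (suc n) e with Fin.any? (λ j → (touches? (proj₁ (e (suc j))) (e zero))
                                               ⊎-dec (touches? (proj₂ (e (suc j))) (e zero)))
  ... | yes (j , meets)
    with u , v , w , uv∼ , vw∼ ← walk (e zero) (e (suc j)) meets
    with o , o∼ , bal ← balancedOrientation n (updateAt (e ∘ suc) j (const (u , w)))
    with subst (o j ∼_) (updateAt-updates j (e ∘ suc)) (o∼ j)
  ... | inj₁ oj≡ = _ , oriented , proj₁ (subdivide-balanced o j oj≡ bal)
    where
    oriented : ∀ i → ((u , v) Vector.∷ updateAt o j (const (v , w))) i ∼ e i
    oriented zero = uv∼
    oriented (suc i) with i Fin.≟ j
    ... | yes refl rewrite updateAt-updates i {const (v , w)} o = vw∼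
    ... | no  i≢j  rewrite updateAt-minimal i j {const (v , w)} o i≢j =
      subst (o i ∼_) (updateAt-minimal i j (e ∘ suc) i≢j) (o∼ i)
  ... | inj₂ oj≡ = _ , oriented , proj₂ (subdivide-balanced o j oj≡ bal)
    where
    oriented : ∀ i → ((v , u) Vector.∷ updateAt o j (const (w , v))) i ∼ e i
    oriented zero = ∼-trans (inj₂ refl) uv∼
    oriented (suc i) with i Fin.≟ j
    ... | yes refl rewrite updateAt-updates i {const (w , v)} o = ∼-trans (inj₂ refl) vw∼
    ... | no  i≢j  rewrite updateAt-minimal i j {const (w , v)} o i≢j =
      subst (o i ∼_) (updateAt-minimal i j (e ∘ suc) i≢j) (o∼ i)
  balancedOrientation (suc n) e | no isolated
    with o , o∼ , bal ← balancedOrientation n (e ∘ suc) = e zero Vector.∷ o , oriented , balanced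
    where
    oriented : ∀ i → (e zero Vector.∷ o) i ∼ e i
    oriented zero    = inj₁ refl
    oriented (suc i) = o∼ i
    untouched : ∀ {x} → Touches x (e zero) → ∀ i → ¬ Touches x (o i)
    untouched t i t′ with Touches-resp-∼ (o∼ i) t′
    ... | inj₁ refl = isolated (i , inj₁ t)
    ... | inj₂ refl = isolated (i , inj₂ t)
    ends : ∀ κ x p → end κ p ≡ x → Touches x p
    ends source x p = inj₁
    ends target x p = inj₂
    bound : ∀ κ x → Touches x (e zero) → degree κ (e zero Vector.∷ o) x ≤ 1
    bound κ x t = ℕ.≤-trans
      (ℕ.≤-reflexive (trans (cong (ind (end κ (e zero) ≟ x) +_)
         (count-none (λ i → end κ (o i) ≟ x) (λ i eq → untouched t i (ends κ x (o i) eq))))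
         (ℕ.+-identityʳ _)))
      (ind≤1 (end κ (e zero) ≟ x))
    balanced : Balanced (e zero Vector.∷ o)
    balanced x with touches? x (e zero)
    ... | yes t = ℕ.≤-trans (bound source x t) (s≤s z≤n) , ℕ.≤-trans (bound target x t) (s≤s z≤n)
    ... | no ¬t rewrite ind-no (proj₁ (e zero) ≟ x) (¬t ∘ inj₁)
                      | ind-no (proj₂ (e zero) ≟ x) (¬t ∘ inj₂) = bal x

-- Edge colourings of the bipartite double

_≟ᶜ_ : DecidableEquality Colour
red  ≟ᶜ red  = yes refl
red  ≟ᶜ blue = no λ ()
blue ≟ᶜ red  = no λ ()
blue ≟ᶜ blue = yes refl

module Colouring {V : Set} (_≟_ : DecidableEquality V) where
  open Multigraph _≟_

  -- The arcs of colour γ whose end κ is x.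
  inClass? : {C : Set} → DecidableEquality C → (e : Vector (V × V) n) (c : Fin n → C) →
             ∀ γ κ x i → Dec (c i ≡ γ × end κ (e i) ≡ x)
  inClass? _≟C_ e c γ κ x i = (c i ≟C γ) ×-dec (end κ (e i) ≟ x)

  classDegree : {C : Set} → DecidableEquality C →
                Vector (V × V) n → (Fin n → C) → C → End → V → ℕ
  classDegree _≟C_ e c γ κ x = count (inClass? _≟C_ e c γ κ x)

  -- The arcs in M can be split into two parts that differ by at most one in the
  -- out-degree, and in the in-degree, of every vertex.  The parts come from a
  -- balanced orientation of the bipartite double, in which every vertex v of the
  -- digraph gives rise to the vertices (source , v) and (target , v).  Arcs outside
  -- M are replaced by loops at the extra vertex `nothing`.
  evenSplit : (e : Vector (V × V) n) {M : Fin n → Set} (M? : ∀ i → Dec (M i)) →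
    let part = λ side c κ x → count (λ i → M? i ×-dec ((side i ≟ᶜ c) ×-dec (end κ (e i) ≟ x))) in
    Σ[ side ∈ (Fin n → Colour) ] ∀ κ x →
      part side red  κ x ≤ suc (part side blue κ x) ×
      part side blue κ x ≤ suc (part side red κ x)
  evenSplit {n} e {M} M? = side , even
    where
    W : Set
    W = Maybe (End × V)
    open Multigraph (Maybe.≡-dec (Product.≡-dec _≟ᵉ_ _≟_))
      using () renaming (balancedOrientation to orientDouble; degree to degreeᵈ)
    lift : V × V → W × W
    lift (u , v) = just (source , u) , just (target , v)
    edge : ∀ {i} → Dec (M i) → W × W
    edge {i} (yes _) = lift (e i)
    edge     (no _)  = nothing , nothing
    direct : Colour → W × W → W × W
    direct red  = id
    direct blue = swap
    colourOf : ∀ {p q : W × W} → p ∼ q → Σ[ c ∈ Colour ] p ≡ direct c q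
    colourOf (inj₁ eq) = red , eq
    colourOf (inj₂ eq) = blue , eq
    result = orientDouble n (λ i → edge (M? i))
    o  = proj₁ result
    side : Fin n → Colour
    side i = proj₁ (colourOf (proj₁ (proj₂ result) i))
    o≡ : ∀ i → o i ≡ direct (side i) (edge (M? i))
    o≡ i = proj₂ (colourOf (proj₁ (proj₂ result) i))
    -- In the orientation of the double, red edges run from the source side to the
    -- target side and blue edges run back.  So the edges of colour c at (κ , x) are
    -- those whose end `flip c κ` is (κ , x).
    flip : Colour → End → End
    flip red  κ      = κ
    flip blue source = target
    flip blue target = source
    outside : ∀ c κ → end κ (direct c (nothing , nothing)) ≡ nothing
    outside red  source = refl
    outside red  target = refl
    outside blue source = refl
    outside blue target = refl
    inside : ∀ c κ p → end (flip c κ) (direct c (lift p)) ≡ just (κ , end κ p)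
    inside red  source p = refl
    inside red  target p = refl
    inside blue source p = refl
    inside blue target p = refl
    inside⁻ : ∀ c c′ κ p {x} → end (flip c κ) (direct c′ (lift p)) ≡ just (κ , x) →
              c′ ≡ c × end κ p ≡ x
    inside⁻ red  red  source p refl = refl , refl
    inside⁻ red  red  target p refl = refl , refl
    inside⁻ blue blue source p refl = refl , refl
    inside⁻ blue blue target p refl = refl , refl
    inside⁻ red  blue source p ()
    inside⁻ red  blue target p ()
    inside⁻ blue red  source p ()
    inside⁻ blue red  target p ()
    same : ∀ c κ x → count (λ i → M? i ×-dec ((side i ≟ᶜ c) ×-dec (end κ (e i) ≟ x)))
                   ≡ degreeᵈ (flip c κ) o (just (κ , x))
    same c κ x = ℕ.≤-antisym (count-mono part? double? to) (count-mono double? part? from)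
      where
      part? = λ i → M? i ×-dec ((side i ≟ᶜ c) ×-dec (end κ (e i) ≟ x))
      double? = λ i → Maybe.≡-dec (Product.≡-dec _≟ᵉ_ _≟_) (end (flip c κ) (o i)) (just (κ , x))
      to : ∀ i → M i × side i ≡ c × end κ (e i) ≡ x → end (flip c κ) (o i) ≡ just (κ , x)
      to i (m , sc , ex) = go (M? i) (o≡ i)
        where
        go : (m? : Dec (M i)) → o i ≡ direct (side i) (edge m?) →
             end (flip c κ) (o i) ≡ just (κ , x)
        go (no ¬m) _  = contradiction m ¬m
        go (yes _) eq = trans
          (cong (end (flip c κ)) (trans eq (cong (λ d → direct d (lift (e i))) sc)))
          (trans (inside c κ (e i)) (cong (λ y → just (κ , y)) ex))
      from : ∀ i → end (flip c κ) (o i) ≡ just (κ , x) → M i × side i ≡ c × end κ (e i) ≡ x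
      from i eq = go (M? i) (o≡ i)
        where
        go : (m? : Dec (M i)) → o i ≡ direct (side i) (edge m?) →
             M i × side i ≡ c × end κ (e i) ≡ x
        go (yes m) o≡i = m , inside⁻ c (side i) κ (e i) (trans (cong (end (flip c κ)) (sym o≡i)) eq)
        go (no ¬m) o≡i with () ← trans (sym (outside (side i) (flip c κ)))
                                   (trans (cong (end (flip c κ)) (sym o≡i)) eq)
    even : ∀ κ x → _
    even source x rewrite same red source x | same blue source x =
      proj₂ (proj₂ result) (just (source , x))
    even target x rewrite same red target x | same blue target x =
      swap (proj₂ (proj₂ result) (just (target , x)))

  module _ {C : Set} (_≟C_ : DecidableEquality C) where

    private
      cdeg : Vector (V × V) n → (Fin n → C) → C → End → V → ℕ
      cdeg = classDegree _≟C_

    -- If every out-degree and every in-degree in the union of the classes α and β is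
    -- at most two, an even split of the union turns these classes into matchings of
    -- the bipartite double.
    balanceClasses : (e : Vector (V × V) n) (c : Fin n → C) {α β : C} → α ≢ β →
      (∀ κ x → cdeg e c α κ x + cdeg e c β κ x ≤ 2) →
      Σ[ c′ ∈ (Fin n → C) ] ∀ κ x →
        cdeg e c′ α κ x ≤ 1 × cdeg e c′ β κ x ≤ 1 ×
        (∀ γ → γ ≢ α → γ ≢ β → cdeg e c′ γ κ x ≤ cdeg e c γ κ x)
    balanceClasses {n} e c {α} {β} α≢β ≤2 = c′ , λ κ x → α≤1 κ x , β≤1 κ x , others κ x
      where
      M : Fin n → Set
      M i = c i ≡ α ⊎ c i ≡ β
      M? : ∀ i → Dec (M i)
      M? i = (c i ≟C α) ⊎-dec (c i ≟C β)
      split = evenSplit e M?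
      side = proj₁ split
      pick : Colour → C
      pick red  = α
      pick blue = β
      recolour : ∀ {i} → Dec (M i) → C
      recolour {i} (yes _) = pick (side i)
      recolour {i} (no _)  = c i
      c′ : Fin n → C
      c′ i = recolour (M? i)
      part? : ∀ b κ x i → Dec (M i × side i ≡ b × end κ (e i) ≡ x)
      part? b κ x i = M? i ×-dec ((side i ≟ᶜ b) ×-dec (end κ (e i) ≟ x))
      pick⁻ : ∀ b d → pick b ≡ pick d → b ≡ d
      pick⁻ red  red  eq = refl
      pick⁻ blue blue eq = refl
      pick⁻ red  blue eq = contradiction eq α≢β
      pick⁻ blue red  eq = contradiction (sym eq) α≢β
      M-pick : ∀ b {i} → c i ≡ pick b → M i
      M-pick red  = inj₁
      M-pick blue = inj₂
      c′≤part : ∀ b κ x → cdeg e c′ (pick b) κ x ≤ count (part? b κ x)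
      c′≤part b κ x = count-mono (inClass? _≟C_ e c′ (pick b) κ x) (part? b κ x) go
        where
        go : ∀ i → c′ i ≡ pick b × end κ (e i) ≡ x → M i × side i ≡ b × end κ (e i) ≡ x
        go i (c′≡ , ex) = case (M? i) c′≡
          where
          case : (m? : Dec (M i)) → recolour m? ≡ pick b → M i × side i ≡ b × end κ (e i) ≡ x
          case (yes m) eq = m , pick⁻ _ _ eq , ex
          case (no ¬m) eq = contradiction (M-pick b eq) ¬m
      parts≤2 : ∀ κ x → count (part? red κ x) + count (part? blue κ x) ≤ 2
      parts≤2 κ x = ℕ.≤-trans
        (count-disjoint (part? red κ x) (part? blue κ x) (λ i → M? i ×-dec (end κ (e i) ≟ x))
          (λ { i (m , _ , ex) → m , ex }) (λ { i (m , _ , ex) → m , ex })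
          (λ { i (_ , s , _) (_ , s′ , _) → contradiction (trans (sym s) s′) λ () }))
        (ℕ.≤-trans
          (count-⊎ (inClass? _≟C_ e c α κ x) (inClass? _≟C_ e c β κ x)
                   (λ i → M? i ×-dec (end κ (e i) ≟ x))
                   (λ { i (m , ex) → Sum.map (_, ex) (_, ex) m }))
          (≤2 κ x))
      α≤1 : ∀ κ x → cdeg e c′ α κ x ≤ 1
      α≤1 κ x = ℕ.≤-trans (c′≤part red κ x)
        (half 1 (proj₁ (proj₂ split κ x)) (parts≤2 κ x))
      β≤1 : ∀ κ x → cdeg e c′ β κ x ≤ 1
      β≤1 κ x = ℕ.≤-trans (c′≤part blue κ x)
        (half 1 (proj₂ (proj₂ split κ x))
          (subst (_≤ 2) (ℕ.+-comm (count (part? red κ x)) _) (parts≤2 κ x)))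
      others : ∀ κ x γ → γ ≢ α → γ ≢ β → cdeg e c′ γ κ x ≤ cdeg e c γ κ x
      others κ x γ γ≢α γ≢β = count-mono (inClass? _≟C_ e c′ γ κ x) (inClass? _≟C_ e c γ κ x) go
        where
        go : ∀ i → c′ i ≡ γ × end κ (e i) ≡ x → c i ≡ γ × end κ (e i) ≡ x
        go i (c′≡ , ex) = case (M? i) c′≡ , ex
          where
          pick≢γ : ∀ b → pick b ≢ γ
          pick≢γ red  = γ≢α ∘ sym
          pick≢γ blue = γ≢β ∘ sym
          case : (m? : Dec (M i)) → recolour m? ≡ γ → c i ≡ γ
          case (no _)  eq = eq
          case (yes _) eq = contradiction eq (pick≢γ (side i))

  -- Arcs of the same colour share neither their source nor their target.
  Proper : ∀ {D} → Vector (V × V) n → (Fin n → Fin D) → Set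
  Proper e c = ∀ γ κ x → classDegree Fin._≟_ e c γ κ x ≤ 1

  -- A vertex of degree less than D misses one of the D colours.
  freeColour : ∀ {D} (e : Vector (V × V) n) (c : Fin n → Fin D) κ x → degree κ e x < D →
               ∃[ γ ] classDegree Fin._≟_ e c γ κ x ≡ 0
  freeColour {D = D} e c κ x deg<D with Fin.any? (λ γ → classDegree Fin._≟_ e c γ κ x ℕ.≟ 0)
  ... | yes free = free
  ... | no  used = contradiction deg<D (ℕ.≤⇒≯ (begin
    D      ≡⟨ ℕ.*-identityʳ D ⟨
    D * 1  ≤⟨ n*c≤sum (λ γ → ℕ.n≢0⇒n>0 (λ eq → used (γ , eq))) ⟩
    sum (λ γ → sum (λ i → ind ((c i Fin.≟ γ) ×-dec (end κ (e i) ≟ x))))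
           ≡⟨ ∑-comm (λ γ i → ind ((c i Fin.≟ γ) ×-dec (end κ (e i) ≟ x))) ⟩
    sum (λ i → sum (λ γ → ind ((c i Fin.≟ γ) ×-dec (end κ (e i) ≟ x))))
           ≤⟨ sum-mono oneColour ⟩
    degree κ e x ∎))
    where
    open ℕ.≤-Reasoning
    oneColour : ∀ i → count (λ γ → (c i Fin.≟ γ) ×-dec (end κ (e i) ≟ x)) ≤ ind (end κ (e i) ≟ x)
    oneColour i with end κ (e i) ≟ x
    ... | yes ex = count-unique (λ γ → (c i Fin.≟ γ) ×-dec yes ex)
                     (λ { γ δ (p , _) (q , _) → trans (sym p) q })
    ... | no ¬ex = ℕ.≤-reflexive (count-none (λ γ → (c i Fin.≟ γ) ×-dec no ¬ex)
                     (λ { γ (_ , ex) → ¬ex ex }))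

  -- The colour α is free at the source of the first arc and β at its target.
  extendColouring : ∀ {D} (e : Vector (V × V) (suc n)) (c : Fin n → Fin D) →
    Proper (e ∘ suc) c → ∀ α β →
    classDegree Fin._≟_ (e ∘ suc) c α source (proj₁ (e zero)) ≡ 0 →
    classDegree Fin._≟_ (e ∘ suc) c β target (proj₂ (e zero)) ≡ 0 →
    Σ[ c ∈ (Fin (suc n) → Fin D) ] Proper e c
  extendColouring {n} {D} e c proper α β freeα freeβ = extend (α Fin.≟ β)
    where
    cdeg : Vector (V × V) k → (Fin k → Fin D) → Fin D → End → V → ℕ
    cdeg = classDegree Fin._≟_
    -- Giving the new edge a colour that is free at its end κ keeps the class
    -- of that colour a matching at that end.
    fits : ∀ γ κ x → cdeg (e ∘ suc) c γ κ (end κ (e zero)) ≡ 0 → cdeg e (γ Vector.∷ c) γ κ x ≤ 1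
    fits γ κ x free = at (end κ (e zero) ≟ x)
      where
      at : Dec (end κ (e zero) ≡ x) → cdeg e (γ Vector.∷ c) γ κ x ≤ 1
      at (yes refl) = ℕ.+-mono-≤ (ind≤1 ((γ Fin.≟ γ) ×-dec (end κ (e zero) ≟ x)))
                                 (ℕ.≤-reflexive free)
      at (no ¬ex)   = ℕ.+-mono-≤
        (ℕ.≤-reflexive (ind-no ((γ Fin.≟ γ) ×-dec (end κ (e zero) ≟ x)) (¬ex ∘ proj₂)))
        (proper γ κ x)
    unchanged : ∀ γ κ x → α ≢ γ → cdeg e (α Vector.∷ c) γ κ x ≤ cdeg (e ∘ suc) c γ κ x
    unchanged γ κ x α≢γ = ℕ.≤-reflexive (cong (_+ cdeg (e ∘ suc) c γ κ x)
      (ind-no ((α Fin.≟ γ) ×-dec (end κ (e zero) ≟ x)) (α≢γ ∘ proj₁)))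
    extend : Dec (α ≡ β) → Σ[ c ∈ (Fin (suc n) → Fin D) ] Proper e c
    extend (yes refl) = α Vector.∷ c , λ γ κ x → at γ κ x (α Fin.≟ γ)
      where
      at : ∀ γ κ x → Dec (α ≡ γ) → cdeg e (α Vector.∷ c) γ κ x ≤ 1
      at γ source x (yes refl) = fits α source x freeα
      at γ target x (yes refl) = fits α target x freeβ
      at γ κ      x (no α≢γ)   = ℕ.≤-trans (unchanged γ κ x α≢γ) (proper γ κ x)
    extend (no α≢β) = proj₁ balanced , λ γ κ x → at γ κ x (γ Fin.≟ α) (γ Fin.≟ β)
      where
      ≤2 : ∀ κ x → cdeg e (α Vector.∷ c) α κ x + cdeg e (α Vector.∷ c) β κ x ≤ 2
      ≤2 source x = ℕ.+-mono-≤ (fits α source x freeα)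
                               (ℕ.≤-trans (unchanged β source x α≢β) (proper β source x))
      -- At the target of the first arc, α may now occur twice, but β does not occur.
      ≤2 target x = at (proj₂ (e zero) ≟ x)
        where
        at : Dec (proj₂ (e zero) ≡ x) →
             cdeg e (α Vector.∷ c) α target x + cdeg e (α Vector.∷ c) β target x ≤ 2
        at (yes refl) = ℕ.+-mono-≤
          (ℕ.+-mono-≤ (ind≤1 ((α Fin.≟ α) ×-dec (proj₂ (e zero) ≟ x))) (proper α target x))
          (ℕ.≤-trans (unchanged β target x α≢β) (ℕ.≤-reflexive freeβ))
        at (no ¬ex) = ℕ.+-mono-≤
          (ℕ.+-mono-≤ (ℕ.≤-reflexive (ind-no ((α Fin.≟ α) ×-dec (proj₂ (e zero) ≟ x)) (¬ex ∘ proj₂)))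
                      (proper α target x))
          (ℕ.≤-trans (unchanged β target x α≢β) (proper β target x))
      balanced = balanceClasses Fin._≟_ e (α Vector.∷ c) α≢β ≤2
      at : ∀ γ κ x → Dec (γ ≡ α) → Dec (γ ≡ β) → cdeg e (proj₁ balanced) γ κ x ≤ 1
      at γ κ x (yes refl) _          = proj₁ (proj₂ balanced κ x)
      at γ κ x (no _)     (yes refl) = proj₁ (proj₂ (proj₂ balanced κ x))
      at γ κ x (no γ≢α)   (no γ≢β)   = ℕ.≤-trans (proj₂ (proj₂ (proj₂ balanced κ x)) γ γ≢α γ≢β)
        (ℕ.≤-trans (unchanged γ κ x (γ≢α ∘ sym)) (proper γ κ x))

  degree-first : (e : Vector (V × V) (suc n)) → ∀ κ →
    degree κ e (end κ (e zero)) ≡ suc (degree κ (e ∘ suc) (end κ (e zero)))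
  degree-first e κ = cong (_+ degree κ (e ∘ suc) (end κ (e zero)))
    (ind-yes (end κ (e zero) ≟ end κ (e zero)) refl)

  -- König's edge colouring theorem, stated for the bipartite double.
  properColouring : ∀ n D (e : Vector (V × V) n) → (∀ κ x → degree κ e x ≤ D) →
                    Σ[ c ∈ (Fin n → Fin D) ] Proper e c
  properColouring zero    D e deg≤D = (λ ()) , λ γ κ x → z≤n
  properColouring (suc n) D e deg≤D
    with c , proper ← properColouring n D (e ∘ suc) (λ κ x → ℕ.≤-trans (ℕ.m≤n+m _ _) (deg≤D κ x))
    with α , freeα ← freeColour (e ∘ suc) c source (proj₁ (e zero))
                       (subst (_≤ D) (degree-first e source) (deg≤D source _))
    with β , freeβ ← freeColour (e ∘ suc) c target (proj₂ (e zero))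
                       (subst (_≤ D) (degree-first e target) (deg≤D target _))
    = extendColouring e c proper α β freeα freeβ

  -- A form of Petersen's 2-factor theorem.
  twoFactorSplit : ∀ a b (e : Vector (V × V) n) → (∀ i → proj₁ (e i) ≢ proj₂ (e i)) →
    (∀ x → count (λ i → touches? x (e i)) ≤ (a + b) + (a + b)) →
    Σ[ c ∈ (Fin n → Colour) ] ∀ x →
      count (λ i → (c i ≟ᶜ red)  ×-dec touches? x (e i)) ≤ a + a ×
      count (λ i → (c i ≟ᶜ blue) ×-dec touches? x (e i)) ≤ b + b
  twoFactorSplit {n} a b e loopless deg≤ = c , λ x →
      bound red  a (_↑ˡ b) onlyRed x , bound blue b (a ↑ʳ_) onlyBlue x
    where
    orientation = balancedOrientation n e
    o = proj₁ orientation
    o∼e = proj₁ (proj₂ orientation)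
    e∼o : ∀ i → e i ∼ o i
    e∼o i = ∼-sym (o∼e i)
    total : ∀ x → degree source o x + degree target o x ≤ (a + b) + (a + b)
    total x = ℕ.≤-trans
      (count-disjoint (λ i → proj₁ (o i) ≟ x) (λ i → proj₂ (o i) ≟ x) (λ i → touches? x (e i))
        (λ i eq → Touches-resp-∼ (o∼e i) (inj₁ eq))
        (λ i eq → Touches-resp-∼ (o∼e i) (inj₂ eq))
        (λ i s t → loopless i (loop (o∼e i) (trans s (sym t)))))
      (deg≤ x)
      where
      loop : {p q : V × V} → p ∼ q → proj₁ p ≡ proj₂ p → proj₁ q ≡ proj₂ q
      loop (inj₁ refl) eq = eq
      loop (inj₂ refl) eq = sym eq
    half-degree : ∀ κ x → degree κ o x ≤ a + b
    half-degree source x = half (a + b) (proj₁ (proj₂ (proj₂ orientation) x)) (total x)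
    half-degree target x = half (a + b) (proj₂ (proj₂ (proj₂ orientation) x))
      (subst (_≤ (a + b) + (a + b)) (ℕ.+-comm (degree source o x) _) (total x))
    colouring = properColouring n (a + b) o half-degree
    γ = proj₁ colouring
    shade : Fin a ⊎ Fin b → Colour
    shade = [ const red , const blue ]′
    c : Fin n → Colour
    c i = shade (splitAt a (γ i))
    onlyRed : ∀ i → c i ≡ red → ∃[ j ] γ i ≡ j ↑ˡ b
    onlyRed i eq with splitAt a (γ i) in split
    ... | inj₁ j = j , sym (Fin.splitAt⁻¹-↑ˡ split)
    onlyBlue : ∀ i → c i ≡ blue → ∃[ j ] γ i ≡ a ↑ʳ j
    onlyBlue i eq with splitAt a (γ i) in split
    ... | inj₂ j = j , sym (Fin.splitAt⁻¹-↑ʳ split)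
    bound : ∀ d k (f : Fin k → Fin (a + b)) → (∀ i → c i ≡ d → ∃[ j ] γ i ≡ f j) →
            ∀ x → count (λ i → (c i ≟ᶜ d) ×-dec touches? x (e i)) ≤ k + k
    bound d k f only x = ℕ.≤-trans
      (count-⊎ (λ i → (c i ≟ᶜ d) ×-dec (end source (o i) ≟ x))
               (λ i → (c i ≟ᶜ d) ×-dec (end target (o i) ≟ x))
               (λ i → (c i ≟ᶜ d) ×-dec touches? x (e i))
               (λ { i (ci , t) → Sum.map (ci ,_) (ci ,_) (Touches-resp-∼ (e∼o i) t) }))
      (ℕ.+-mono-≤ (side source) (side target))
      where
      side : ∀ κ → count (λ i → (c i ≟ᶜ d) ×-dec (end κ (o i) ≟ x)) ≤ k
      side κ = subst (count (λ i → (c i ≟ᶜ d) ×-dec (end κ (o i) ≟ x)) ≤_) (ℕ.*-identityʳ k)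
        (count-cover (λ i → (c i ≟ᶜ d) ×-dec (end κ (o i) ≟ x))
          (λ j i → inClass? Fin._≟_ o γ (f j) κ x i) 1
          (λ j → proj₂ colouring (f j) κ x)
          (λ { i (ci , ex) → proj₁ (only i ci) , proj₂ (only i ci) , ex }))

-- Systems of distinct representatives

-- A greedy choice works if the i-th set, counting from zero, has more than i + k
-- elements, where k elements are excluded from the outset.
representatives : ∀ {k} s {Q : Fin s → Fin n → Set} (Q? : ∀ i q → Dec (Q i q))
  (used : Fin k → Fin n) →
  (∀ i → suc (toℕ i + k) ≤ count (Q? i)) →
  Σ[ σ ∈ (Fin s → Fin n) ] Injective _≡_ _≡_ σ × (∀ i → Q i (σ i)) × (∀ i j → σ i ≢ used j)
representatives zero Q? used many = (λ ()) , (λ { {()} }) , (λ ()) , λ ()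
representatives {n} {k} (suc s) {Q} Q? used many
  with Fin.any? (λ q → Q? zero q ×-dec Fin.all? (λ j → ¬? (q Fin.≟ used j)))
... | no none = contradiction (many zero) (ℕ.≤⇒≯ (subst (count (Q? zero) ≤_) (ℕ.*-identityʳ k)
  (count-cover (Q? zero) (λ j q → q Fin.≟ used j) 1
    (λ j → count-unique (λ q → q Fin.≟ used j) (λ p q e e′ → trans e (sym e′)))
    cover)))
  where
  cover : ∀ q → Q zero q → ∃[ j ] q ≡ used j
  cover q Qq with Fin.any? (λ j → q Fin.≟ used j)
  ... | yes hit = hit
  ... | no miss = contradiction (q , Qq , λ j eq → miss (j , eq)) none
... | yes (q , Qq , new)
  with σ , inj , Qσ , avoid ← representatives s (Q? ∘ suc) (q Vector.∷ used)
         (λ i → subst (_≤ count (Q? (suc i))) (cong suc (sym (ℕ.+-suc (toℕ i) k))) (many (suc i)))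
  = q Vector.∷ σ , inj′ , Qσ′ , avoid′
  where
  inj′ : Injective _≡_ _≡_ (q Vector.∷ σ)
  inj′ {zero}  {zero}  eq = refl
  inj′ {zero}  {suc j} eq = contradiction (sym eq) (avoid j zero)
  inj′ {suc i} {zero}  eq = contradiction eq (avoid i zero)
  inj′ {suc i} {suc j} eq = cong suc (inj eq)
  Qσ′ : ∀ i → Q i ((q Vector.∷ σ) i)
  Qσ′ zero    = Qq
  Qσ′ (suc i) = Qσ i
  avoid′ : ∀ i j → (q Vector.∷ σ) i ≢ used j
  avoid′ zero    j = new j
  avoid′ (suc i) j = avoid i (suc j)

distinctRepresentatives : {Q : Fin s → Fin n → Set} (Q? : ∀ i q → Dec (Q i q)) →
  (∀ i → toℕ i < count (Q? i)) →
  Σ[ σ ∈ (Fin s → Fin n) ] Injective _≡_ _≡_ σ × (∀ i → Q i (σ i))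
distinctRepresentatives {s = s} Q? many
  with σ , inj , Qσ , _ ← representatives {k = 0} s Q? (λ ())
         (λ i → subst (λ z → suc z ≤ count (Q? i)) (sym (ℕ.+-identityʳ (toℕ i))) (many i))
  = σ , inj , Qσ

-- Disjoint unions of families of graphs

-- A vertex of one of the graphs; `place` and `locate` are the mutually inverse
-- maps to and from the vertices of the disjoint union.
Part : (Fin s → Graph) → Set
Part {s} F = Σ[ i ∈ Fin s ] Fin (Graph.order (F i))

place : (F : Fin s → Graph) → Part F → Fin (Graph.order (⨆ F))
place F (zero  , v) = v ↑ˡ _
place F (suc i , v) = _ ↑ʳ place (F ∘ suc) (i , v)

shift : (F : Fin (suc s) → Graph) → Part (F ∘ suc) → Part F
shift F (i , v) = suc i , v

locate : (F : Fin s → Graph) → Fin (Graph.order (⨆ F)) → Part F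
locate {suc s} F w with splitAt (Graph.order (F zero)) w
... | inj₁ v  = zero , v
... | inj₂ w′ = shift F (locate (F ∘ suc) w′)

place-locate : (F : Fin s → Graph) → ∀ w → place F (locate F w) ≡ w
place-locate {suc s} F w with splitAt (Graph.order (F zero)) w in eq
... | inj₁ v  = Fin.splitAt⁻¹-↑ˡ eq
... | inj₂ w′ = trans (cong (_ ↑ʳ_) (place-locate (F ∘ suc) w′)) (Fin.splitAt⁻¹-↑ʳ eq)

locate-place : (F : Fin s → Graph) → ∀ p → locate F (place F p) ≡ p
locate-place F (zero , v)
  rewrite Fin.splitAt-↑ˡ (Graph.order (F zero)) v (Graph.order (⨆ (F ∘ suc))) = refl
locate-place F (suc i , v)
  rewrite Fin.splitAt-↑ʳ (Graph.order (F zero)) (Graph.order (⨆ (F ∘ suc))) (place (F ∘ suc) (i , v))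
  = cong (shift F) (locate-place (F ∘ suc) (i , v))

place-injective : (F : Fin s → Graph) → Injective _≡_ _≡_ (place F)
place-injective F {p} {q} eq =
  trans (sym (locate-place F p)) (trans (cong (locate F) eq) (locate-place F q))

locate-injective : (F : Fin s → Graph) → Injective _≡_ _≡_ (locate F)
locate-injective F {p} {q} eq =
  trans (sym (place-locate F p)) (trans (cong (place F) eq) (place-locate F q))

place-adjacent : (F : Fin s → Graph) → ∀ i {u v} → Graph._~_ (F i) u v →
                 Graph._~_ (⨆ F) (place F (i , u)) (place F (i , v))
place-adjacent F zero {u} {v} e
  rewrite Fin.splitAt-↑ˡ (Graph.order (F zero)) u (Graph.order (⨆ (F ∘ suc)))
        | Fin.splitAt-↑ˡ (Graph.order (F zero)) v (Graph.order (⨆ (F ∘ suc))) = inj₁ e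
place-adjacent F (suc i) {u} {v} e
  rewrite Fin.splitAt-↑ʳ (Graph.order (F zero)) (Graph.order (⨆ (F ∘ suc))) (place (F ∘ suc) (i , u))
        | Fin.splitAt-↑ʳ (Graph.order (F zero)) (Graph.order (⨆ (F ∘ suc))) (place (F ∘ suc) (i , v))
  = inj₂ (place-adjacent (F ∘ suc) i e)

-- Adjacency of vertices within the same component.
data AdjacentParts (F : Fin s → Graph) : Part F → Part F → Set where
  within : ∀ i {u v} → Graph._~_ (F i) u v → AdjacentParts F (i , u) (i , v)

locate-adjacent : (F : Fin s → Graph) → ∀ {w w′} → Graph._~_ (⨆ F) w w′ →
                  AdjacentParts F (locate F w) (locate F w′)
locate-adjacent {suc s} F {w} {w′} e
  with splitAt (Graph.order (F zero)) w | splitAt (Graph.order (F zero)) w′ | e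
... | inj₁ _ | inj₁ _ | inj₁ e′ = within zero e′
... | inj₂ _ | inj₂ _ | inj₂ e′ = step (locate-adjacent (F ∘ suc) e′)
  where
  step : ∀ {p q} → AdjacentParts (F ∘ suc) p q → AdjacentParts F (shift F p) (shift F q)
  step (within i e) = within (suc i) e

-- Sizes of disjoint unions and stars

length-filter-tabulate : {A : Set} {P : A → Set} (P? : ∀ x → Dec (P x)) (f : Vector A n) →
                         length (filter P? (tabulate f)) ≡ count (P? ∘ f)
length-filter-tabulate {zero}  P? f = refl
length-filter-tabulate {suc n} P? f with P? (f zero)
... | yes _ = cong suc (length-filter-tabulate P? (f ∘ suc))
... | no  _ = length-filter-tabulate P? (f ∘ suc)

length-filter-product : {A B : Set} {P : A × B → Set} (P? : ∀ x → Dec (P x))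
  (f : Vector A n) (g : Vector B k) →
  length (filter P? (cartesianProduct (tabulate f) (tabulate g))) ≡
  sum (λ i → count (λ j → P? (f i , g j)))
length-filter-product {zero}  P? f g = refl
length-filter-product {suc n} P? f g = begin
  length (filter P? (row ++ rest))
    ≡⟨ cong length (List.filter-++ P? row rest) ⟩
  length (filter P? row ++ filter P? rest)
    ≡⟨ List.length-++ (filter P? row) ⟩
  length (filter P? row) + length (filter P? rest)
    ≡⟨ cong (λ r → length (filter P? r) + length (filter P? rest)) (List.map-tabulate g (f zero ,_)) ⟩
  length (filter P? (tabulate (λ j → f zero , g j))) + length (filter P? rest)
    ≡⟨ cong₂ _+_ (length-filter-tabulate P? (λ j → f zero , g j))
                 (length-filter-product P? (f ∘ suc) g) ⟩
  sum (λ i → count (λ j → P? (f i , g j))) ∎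
  where
  open ≡-Reasoning
  row  = map (f zero ,_) (tabulate g)
  rest = cartesianProduct (tabulate (f ∘ suc)) (tabulate g)

-- Each edge is counted at its smaller endpoint u.
forward? : (G : Graph) → ∀ u v → Dec (u Fin.< v × Graph._~_ G u v)
forward? G u v = (u Fin.<? v) ×-dec Graph._~?_ G u v

size-count : ∀ G → Graph.size G ≡ sum (λ u → count (forward? G u))
size-count G = length-filter-product (λ (u , v) → forward? G u v) id id

sum-splitAt : ∀ a {b} (f : Vector ℕ (a + b)) →
              sum f ≡ sum (λ i → f (i ↑ˡ b)) + sum (λ j → f (a ↑ʳ j))
sum-splitAt zero    f = refl
sum-splitAt (suc a) f = trans (cong (f zero +_) (sum-splitAt a (f ∘ suc)))
  (sym (ℕ.+-assoc (f zero) _ _))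

size-⊔ : ∀ G H → Graph.size (G ⊔ H) ≡ Graph.size G + Graph.size H
size-⊔ G H = begin
  Graph.size (G ⊔ H)                         ≡⟨ size-count (G ⊔ H) ⟩
  sum (λ u → count (forward? (G ⊔ H) u))     ≡⟨ sum-splitAt a (λ u → count (forward? (G ⊔ H) u)) ⟩
  sum (λ i → count (forward? (G ⊔ H) (i ↑ˡ b))) + sum (λ j → count (forward? (G ⊔ H) (a ↑ʳ j)))
    ≡⟨ cong₂ _+_ (sum-cong-≗ left) (sum-cong-≗ right) ⟩
  sum (λ i → count (forward? G i)) + sum (λ j → count (forward? H j))
    ≡⟨ cong₂ _+_ (size-count G) (size-count H) ⟨
  Graph.size G + Graph.size H                ∎
  where
  open ≡-Reasoning
  a = Graph.order G
  b = Graph.order H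
  Adj : Fin a ⊎ Fin b → Fin a ⊎ Fin b → Set
  Adj = Pointwise (Graph._~_ G) (Graph._~_ H)
  ˡ : ∀ i → splitAt a (i ↑ˡ b) ≡ inj₁ i
  ˡ i = Fin.splitAt-↑ˡ a i b
  ʳ : ∀ j → splitAt a (a ↑ʳ j) ≡ inj₂ j
  ʳ j = Fin.splitAt-↑ʳ a b j
  left : ∀ i → count (forward? (G ⊔ H) (i ↑ˡ b)) ≡ count (forward? G i)
  left i = begin
    count (forward? (G ⊔ H) (i ↑ˡ b))
      ≡⟨ sum-splitAt a (λ v → ind (forward? (G ⊔ H) (i ↑ˡ b) v)) ⟩
    count (λ i′ → forward? (G ⊔ H) (i ↑ˡ b) (i′ ↑ˡ b)) +
    count (λ j → forward? (G ⊔ H) (i ↑ˡ b) (a ↑ʳ j))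
      ≡⟨ cong₂ _+_ (sum-cong-≗ (λ i′ → ind-cong (forward? (G ⊔ H) (i ↑ˡ b) (i′ ↑ˡ b)) (forward? G i i′)
                                         (to i′) (from i′)))
                   (count-none (λ j → forward? (G ⊔ H) (i ↑ˡ b) (a ↑ʳ j)) cross) ⟩
    count (forward? G i) + 0 ≡⟨ ℕ.+-identityʳ _ ⟩
    count (forward? G i)     ∎
    where
    to : ∀ i′ → (i ↑ˡ b) Fin.< (i′ ↑ˡ b) × Graph._~_ (G ⊔ H) (i ↑ˡ b) (i′ ↑ˡ b) →
         i Fin.< i′ × Graph._~_ G i i′
    to i′ (lt , e) with inj₁ e′ ← subst₂ Adj (ˡ i) (ˡ i′) e =
      subst₂ _<_ (Fin.toℕ-↑ˡ i b) (Fin.toℕ-↑ˡ i′ b) lt , e′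
    from : ∀ i′ → i Fin.< i′ × Graph._~_ G i i′ →
           (i ↑ˡ b) Fin.< (i′ ↑ˡ b) × Graph._~_ (G ⊔ H) (i ↑ˡ b) (i′ ↑ˡ b)
    from i′ (lt , e) = subst₂ _<_ (sym (Fin.toℕ-↑ˡ i b)) (sym (Fin.toℕ-↑ˡ i′ b)) lt ,
      subst₂ Adj (sym (ˡ i)) (sym (ˡ i′)) (inj₁ e)
    cross : ∀ j → ¬ ((i ↑ˡ b) Fin.< (a ↑ʳ j) × Graph._~_ (G ⊔ H) (i ↑ˡ b) (a ↑ʳ j))
    cross j (_ , e) with () ← subst₂ Adj (ˡ i) (ʳ j) e
  right : ∀ j → count (forward? (G ⊔ H) (a ↑ʳ j)) ≡ count (forward? H j)
  right j = begin
    count (forward? (G ⊔ H) (a ↑ʳ j))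
      ≡⟨ sum-splitAt a (λ v → ind (forward? (G ⊔ H) (a ↑ʳ j) v)) ⟩
    count (λ i → forward? (G ⊔ H) (a ↑ʳ j) (i ↑ˡ b)) +
    count (λ j′ → forward? (G ⊔ H) (a ↑ʳ j) (a ↑ʳ j′))
      ≡⟨ cong₂ _+_ (count-none (λ i → forward? (G ⊔ H) (a ↑ʳ j) (i ↑ˡ b)) cross)
                   (sum-cong-≗ (λ j′ → ind-cong (forward? (G ⊔ H) (a ↑ʳ j) (a ↑ʳ j′)) (forward? H j j′)
                                         (to j′) (from j′))) ⟩
    count (forward? H j)     ∎
    where
    to : ∀ j′ → (a ↑ʳ j) Fin.< (a ↑ʳ j′) × Graph._~_ (G ⊔ H) (a ↑ʳ j) (a ↑ʳ j′) →
         j Fin.< j′ × Graph._~_ H j j′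
    to j′ (lt , e) with inj₂ e′ ← subst₂ Adj (ʳ j) (ʳ j′) e =
      ℕ.+-cancelˡ-< a _ _ (subst₂ _<_ (Fin.toℕ-↑ʳ a j) (Fin.toℕ-↑ʳ a j′) lt) , e′
    from : ∀ j′ → j Fin.< j′ × Graph._~_ H j j′ →
           (a ↑ʳ j) Fin.< (a ↑ʳ j′) × Graph._~_ (G ⊔ H) (a ↑ʳ j) (a ↑ʳ j′)
    from j′ (lt , e) =
      subst₂ _<_ (sym (Fin.toℕ-↑ʳ a j)) (sym (Fin.toℕ-↑ʳ a j′)) (ℕ.+-monoʳ-< a lt) ,
      subst₂ Adj (sym (ʳ j)) (sym (ʳ j′)) (inj₂ e)
    cross : ∀ i → ¬ ((a ↑ʳ j) Fin.< (i ↑ˡ b) × Graph._~_ (G ⊔ H) (a ↑ʳ j) (i ↑ˡ b))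
    cross i (_ , e) with () ← subst₂ Adj (ʳ j) (ˡ i) e

size-star : ∀ n → Graph.size (K₁, n) ≡ n
size-star n = begin
  Graph.size (K₁, n)  ≡⟨ size-count (K₁, n) ⟩
  count (forward? (K₁, n) zero) + sum (λ i → count (forward? (K₁, n) (suc i)))
    ≡⟨ cong₂ _+_ fromRoot fromLeaves ⟩
  n + 0               ≡⟨ ℕ.+-identityʳ n ⟩
  n                   ∎
  where
  open ≡-Reasoning
  fromRoot : count (forward? (K₁, n) zero) ≡ n
  fromRoot = ℕ.≤-antisym
    (subst (count (forward? (K₁, n) zero) ≤_) (ℕ.*-identityʳ n)
      (sum≤n*c (λ i → ind≤1 (forward? (K₁, n) zero (suc i)))))
    (injection⇒≤count (forward? (K₁, n) zero) suc Fin.suc-injective (λ i → s≤s z≤n , root-leaf i))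
  fromLeaves : sum (λ i → count (forward? (K₁, n) (suc i))) ≡ 0
  fromLeaves = ℕ.n≤0⇒n≡0 (subst (sum (λ i → count (forward? (K₁, n) (suc i))) ≤_) (ℕ.*-zeroʳ n)
    (sum≤n*c (λ i → ℕ.≤-reflexive (count-none (forward? (K₁, n) (suc i))
      λ { .zero (() , leaf-root _) }))))

size-⨆ : (F : Fin s → Graph) → Graph.size (⨆ F) ≡ sum (Graph.size ∘ F)
size-⨆ {zero}  F = refl
size-⨆ {suc s} F = trans (size-⊔ (F zero) (⨆ (F ∘ suc)))
  (cong (Graph.size (F zero) +_) (size-⨆ (F ∘ suc)))

-- The numbers l_k

sum-applyUpTo : ∀ (f g : ℕ → ℕ) p → sumList (map f (applyUpTo g p)) ≡ sum {p} (λ q → f (g (toℕ q)))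
sum-applyUpTo f g zero    = refl
sum-applyUpTo f g (suc p) = cong (f (g 0) +_) (sum-applyUpTo f (g ∘ suc) p)

private
  -- The index pairs over which l takes the maximum, for the given k.
  pairs : ∀ s t → ℕ → List (Fin s × Fin t)
  pairs s t k = filter (λ (a , b) → suc (toℕ a) + suc (toℕ b) ℕ.≟ k)
                       (cartesianProduct (allFin s) (allFin t))

module _ (n : Fin s → ℕ) (m : Fin t → ℕ) where

  private
    value : Fin s × Fin t → ℕ
    value (a , b) = n a + m b ∸ 1

  -- With indices counted from zero, the pair i, j belongs to k = i + j + 2.
  l-upper : ∀ i j {q} → toℕ i + toℕ j ≡ q → n i + m j ∸ 1 ≤ l n m (2 + q)
  l-upper i j {q} refl = All.lookup (xs≤max 0 (map value (pairs s t (2 + q))))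
    (∈-map⁺ value (∈-filter⁺ (λ (a , b) → suc (toℕ a) + suc (toℕ b) ℕ.≟ 2 + q)
      (∈-cartesianProduct⁺ (∈-allFin i) (∈-allFin j)) (cong suc (ℕ.+-suc (toℕ i) (toℕ j)))))

  -- The pair i₀, j₀ shows that the maximum is not over an empty set.
  l-attained : ∀ q i₀ j₀ → toℕ i₀ + toℕ j₀ ≡ q →
               ∃[ i ] ∃[ j ] toℕ i + toℕ j ≡ q × l n m (2 + q) ≡ n i + m j ∸ 1
  l-attained q i₀ j₀ eq₀ with argmax-sel id 0 (map value (pairs s t (2 + q)))
  -- If the default value 0 is returned, every pair for q has the value 0.
  ... | inj₁ max≡0 = i₀ , j₀ , eq₀ ,
    trans max≡0 (sym (ℕ.n≤0⇒n≡0 (subst (n i₀ + m j₀ ∸ 1 ≤_) max≡0 (l-upper i₀ j₀ eq₀))))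
  ... | inj₂ max∈ with (i , j) , ij∈ , eq ← ∈-map⁻ value max∈ =
    i , j ,
    ℕ.suc-injective (ℕ.suc-injective (trans (cong suc (sym (ℕ.+-suc (toℕ i) (toℕ j))))
      (proj₂ (∈-filter⁻ (λ (a , b) → suc (toℕ a) + suc (toℕ b) ℕ.≟ 2 + q)
                        {xs = cartesianProduct (allFin s) (allFin t)} ij∈)))) ,
    eq

-- A number q ≤ i + j is a sum of indices i′ ≤ i and j′ ≤ j, namely of
-- i′ = min (q , i) and j′ = q - i′.
splitBelow : (i : Fin s) (j : Fin t) → ∀ {q} → q ≤ toℕ i + toℕ j →
             ∃[ i′ ] ∃[ j′ ] i′ Fin.≤ i × j′ Fin.≤ j × toℕ {s} i′ + toℕ {t} j′ ≡ q
splitBelow i j {q} q≤ = fromℕ< a<s , fromℕ< b<t ,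
    subst (_≤ toℕ i) (sym (Fin.toℕ-fromℕ< a<s)) (ℕ.m⊓n≤n q (toℕ i)) ,
    subst (_≤ toℕ j) (sym (Fin.toℕ-fromℕ< b<t)) b≤ ,
    trans (cong₂ _+_ (Fin.toℕ-fromℕ< a<s) (Fin.toℕ-fromℕ< b<t)) (ℕ.m+[n∸m]≡n (ℕ.m⊓n≤m q (toℕ i)))
  where
  a<s = ℕ.≤-<-trans (ℕ.m⊓n≤n q (toℕ i)) (Fin.toℕ<n i)
  b≤ : q ∸ (q ⊓ toℕ i) ≤ toℕ j
  b≤ with ℕ.≤-total q (toℕ i)
  ... | inj₁ q≤i rewrite ℕ.m≤n⇒m⊓n≡m q≤i | ℕ.n∸n≡0 q = z≤n
  ... | inj₂ i≤q rewrite ℕ.m≥n⇒m⊓n≡n i≤q = ℕ.m≤n+o⇒m∸n≤o q (toℕ i) q≤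
  b<t = ℕ.≤-<-trans b≤ (Fin.toℕ<n j)

largestIndex : ∀ s → .{{NonZero s}} → Σ[ i ∈ Fin s ] suc (toℕ i) ≡ s
largestIndex (suc s) = Fin.fromℕ s , cong suc (Fin.toℕ-fromℕ s)

indexPair : ∀ s t → .{{NonZero s}} → .{{NonZero t}} → ∀ {q} → q < s + t ∸ 1 →
            ∃[ i ] ∃[ j ] toℕ {s} i + toℕ {t} j ≡ q
indexPair (suc s) (suc t) {q} q<
  with i , i≡ ← largestIndex (suc s) | j , j≡ ← largestIndex (suc t)
  with i′ , j′ , _ , _ , eq ← splitBelow i j (s≤s⁻¹ (subst (suc q ≤_)
         (trans (ℕ.+-suc s t)
                (cong suc (sym (cong₂ _+_ (ℕ.suc-injective i≡) (ℕ.suc-injective j≡))))) q<))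
  = i′ , j′ , eq

odd : ∀ n → parity n ≡ 1ℙ → ∃[ a ] n ≡ suc (a + a)
odd 1             refl = 0 , refl
odd (suc (suc n)) p with a , eq ← odd n p =
  suc a , cong suc (trans (cong suc eq) (cong suc (sym (ℕ.+-suc a a))))

-- The upper bound

starForest : (Fin s → ℕ) → Graph
starForest n = ⨆ (λ i → K₁, n i)

-- The stars of a forest of stars under an edge colouring.
module Forest {p} (L : Fin p → ℕ) (χ : EdgeColouring (starForest L)) where
  open EdgeColouring χ
  private
    G = starForest L
    F = λ q → K₁, L q

  -- The colour of the edge from the root of star q to its leaf a.
  leafColour : ∀ q → Fin (L q) → Colour
  leafColour q a = colour {place F (q , zero)} {place F (q , suc a)} (place-adjacent F q (root-leaf a))

  -- The number of edges of colour c in star q.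
  colourDegree : Colour → Fin p → ℕ
  colourDegree c q = count (λ a → leafColour q a ≟ᶜ c)

  L≤degrees : ∀ q → L q ≤ colourDegree red q + colourDegree blue q
  L≤degrees q = ℕ.≤-trans
    (injection⇒≤count (λ a → (leafColour q a ≟ᶜ red) ⊎-dec (leafColour q a ≟ᶜ blue)) id id
      (λ a → either (leafColour q a)))
    (count-⊎ (λ a → leafColour q a ≟ᶜ red) (λ a → leafColour q a ≟ᶜ blue)
      (λ a → (leafColour q a ≟ᶜ red) ⊎-dec (leafColour q a ≟ᶜ blue)) (λ a → id))
    where
    either : ∀ c → c ≡ red ⊎ c ≡ blue
    either red  = inj₁ refl
    either blue = inj₂ refl

  module _ (c : Colour) {s} (n : Fin s → ℕ) where

    -- Star i of the smaller forest is placed inside star σ i.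
    forestCopy : (σ : Fin s → Fin p) → Injective _≡_ _≡_ σ →
                 (f : ∀ i → Fin (n i) → Fin (L (σ i))) → (∀ i → Injective _≡_ _≡_ (f i)) →
                 (∀ i a → leafColour (σ i) (f i a) ≡ c) →
                 MonochromaticCopy (starForest n) G χ c
    forestCopy σ σ-inj f f-inj coloured = record
      { embed     = place F ∘ φ ∘ locate H
      ; injective = locate-injective H ∘ φ-injective ∘ place-injective F
      ; edge      = λ e → φ-edge (locate-adjacent H e)
      }
      where
      H : Fin s → Graph
      H i = K₁, n i
      vertex : ∀ i → Fin (suc (n i)) → Fin (suc (L (σ i)))
      vertex i zero    = zero
      vertex i (suc a) = suc (f i a)
      φ : Part H → Part F
      φ (i , v) = σ i , vertex i v
      vertex-injective : ∀ i → Injective _≡_ _≡_ (vertex i)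
      vertex-injective i {zero}  {zero}  eq = refl
      vertex-injective i {suc a} {suc b} eq = cong suc (f-inj i (Fin.suc-injective eq))
      ,-injective : ∀ {q} {u v : Fin (suc (L q))} → _≡_ {A = Part F} (q , u) (q , v) → u ≡ v
      ,-injective refl = refl
      φ-injective : Injective _≡_ _≡_ φ
      φ-injective {i , u} {j , v} eq with refl ← σ-inj (cong proj₁ eq) =
        cong (i ,_) (vertex-injective i (,-injective eq))
      φ-edge : ∀ {x y} → AdjacentParts H x y →
               Σ[ e ∈ Graph._~_ G (place F (φ x)) (place F (φ y)) ] colour e ≡ c
      φ-edge (within i (root-leaf a)) = place-adjacent F (σ i) (root-leaf (f i a)) , coloured i a
      φ-edge (within i (leaf-root a)) = place-adjacent F (σ i) (leaf-root (f i a)) ,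
        trans (undirected _ _) (coloured i a)

    -- With i counted from zero, a shortage means that at most i stars have n_i edges
    -- of colour c.
    forestOrShortage : MonochromaticCopy (starForest n) G χ c ⊎
                       ∃[ i ] count (λ q → n i ℕ.≤? colourDegree c q) ≤ toℕ i
    forestOrShortage with Fin.all? (λ i → toℕ i ℕ.<? count (λ q → n i ℕ.≤? colourDegree c q))
    ... | no shortage
      with i , ≮ ← Fin.¬∀⟶∃¬ s _ (λ i → toℕ i ℕ.<? count (λ q → n i ℕ.≤? colourDegree c q)) shortage
      = inj₂ (i , ℕ.≮⇒≥ ≮)
    ... | yes many
      with σ , σ-inj , large ← distinctRepresentatives (λ i q → n i ℕ.≤? colourDegree c q) many
      = inj₁ (forestCopy σ σ-inj (λ i → proj₁ (leaves i)) (λ i → proj₁ (proj₂ (leaves i)))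
                                 (λ i → proj₂ (proj₂ (leaves i))))
      where
      leaves : ∀ i → Σ[ f ∈ (Fin (n i) → Fin (L (σ i))) ]
                     Injective _≡_ _≡_ f × (∀ a → leafColour (σ i) (f a) ≡ c)
      leaves i = distinctRepresentatives (λ _ b → leafColour (σ i) b ≟ᶜ c)
        (λ a → ℕ.<-≤-trans (Fin.toℕ<n a) (large i))

module Upper (s t : ℕ) .{{_ : NonZero s}} .{{_ : NonZero t}} (n : Fin s → ℕ) (m : Fin t → ℕ) where

  -- The host forest: star q is K₁,l_k for k = q + 2.
  L : Fin (s + t ∸ 1) → ℕ
  L q = l n m (2 + toℕ q)

  size-forest : Graph.size (starForest L) ≡ sumFrom2To (s + t) (l n m)
  size-forest = trans (size-⨆ (λ q → K₁, L q))
    (trans (sum-cong-≗ (λ q → size-star (L q))) (sym (sum-applyUpTo (l n m) (2 +_) (s + t ∸ 1))))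

  noIsolated : (∀ i j → 1 ≤ n i + m j ∸ 1) → NoIsolatedVertices (starForest L)
  noIsolated positive u = subst (λ w → ∃[ v ] Graph._~_ (starForest L) w v)
    (place-locate F u) (neighbour (locate F u))
    where
    F = λ q → K₁, L q
    1≤L : ∀ q → 1 ≤ L q
    1≤L q with i , j , eq ← indexPair s t (Fin.toℕ<n q) =
      ℕ.≤-trans (positive i j) (l-upper n m i j eq)
    neighbour : ∀ p → ∃[ v ] Graph._~_ (starForest L) (place F p) v
    neighbour (q , zero)  = place F (q , suc (fromℕ< (1≤L q))) , place-adjacent F q (root-leaf _)
    neighbour (q , suc a) = place F (q , zero) , place-adjacent F q (leaf-root a)

  arrows : Antitonic₁ Fin._≤_ _≤_ n → Antitonic₁ Fin._≤_ _≤_ m →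
           starForest L ⟶⟨ starForest n , starForest m ⟩
  arrows n-anti m-anti χ
    with Forest.forestOrShortage L χ red n | Forest.forestOrShortage L χ blue m
  ... | inj₁ copy | _         = inj₁ copy
  ... | inj₂ _    | inj₁ copy = inj₂ copy
  ... | inj₂ (i , few) | inj₂ (j , few′) =
    contradiction (ℕ.≤-trans enough (ℕ.+-mono-≤ few few′)) ℕ.1+n≰n
    where
    open Forest L χ
    red? = λ q → n i ℕ.≤? colourDegree red q
    blue? = λ q → m j ℕ.≤? colourDegree blue q
    enough-stars : suc (toℕ i + toℕ j) ≤ s + t ∸ 1
    enough-stars = subst (_≤ s + t ∸ 1) (ℕ.+-suc (toℕ i) (toℕ j))
      (ℕ.∸-monoˡ-≤ 1 (ℕ.+-mono-≤ (Fin.toℕ<n i) (Fin.toℕ<n j)))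
    large : ∀ q → toℕ q ≤ toℕ i + toℕ j → n i + m j ∸ 1 ≤ L q
    large q q≤ with i′ , j′ , i′≤i , j′≤j , eq ← splitBelow i j q≤ =
      ℕ.≤-trans (ℕ.∸-monoˡ-≤ 1 (ℕ.+-mono-≤ (n-anti i′≤i) (m-anti j′≤j))) (l-upper n m i′ j′ eq)
    redOrBlue : ∀ q → toℕ q ≤ toℕ i + toℕ j → n i ≤ colourDegree red q ⊎ m j ≤ colourDegree blue q
    redOrBlue q q≤ with red? q | blue? q
    ... | yes r | _     = inj₁ r
    ... | no _  | yes b = inj₂ b
    ... | no ¬r | no ¬b = contradiction
      (ℕ.≤-trans (subst (_≤ n i + m j ∸ 1) (ℕ.+-suc _ _)
                   (ℕ.∸-monoˡ-≤ 1 (ℕ.+-mono-≤ (ℕ.≰⇒> ¬r) (ℕ.≰⇒> ¬b))))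
                 (ℕ.≤-trans (large q q≤) (L≤degrees q))) ℕ.1+n≰n
    enough : suc (toℕ i + toℕ j) ≤ count red? + count blue?
    enough = ℕ.≤-trans
      (injection⇒≤count (λ q → red? q ⊎-dec blue? q) (λ x → Fin.inject≤ x enough-stars)
        (λ eq → Fin.inject≤-injective enough-stars enough-stars _ _ eq)
        (λ x → redOrBlue (Fin.inject≤ x enough-stars)
          (subst (_≤ toℕ i + toℕ j) (sym (Fin.toℕ-inject≤ x enough-stars)) (s≤s⁻¹ (Fin.toℕ<n x)))))
      (count-⊎ red? blue? (λ q → red? q ⊎-dec blue? q) (λ q → id))

-- The lower bound

length-filter : {A : Set} {P : A → Set} (P? : ∀ x → Dec (P x)) (xs : List A) →
  length xs ≡ count (λ p → P? (List.lookup xs p)) + length (filter (λ x → ¬? (P? x)) xs)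
length-filter P? [] = refl
length-filter P? (x ∷ xs) with P? x
... | yes _ = cong suc (length-filter P? xs)
... | no  _ = trans (cong suc (length-filter P? xs)) (sym (ℕ.+-suc _ _))

module LowerBound (G : Graph) where
  open Graph G
  open Multigraph (Fin._≟_ {order}) using (Touches; touches?; Touches-resp-∼)
  open Colouring (Fin._≟_ {order}) using (twoFactorSplit)

  private
    V = Fin order

  -- The pair of u and v with its smaller vertex first, as in `edges`.
  sorted : V → V → V × V
  sorted u v with u Fin.<? v
  ... | yes _ = u , v
  ... | no  _ = v , u

  sorted-∼ : ∀ u v → sorted u v ∼ (u , v)
  sorted-∼ u v with u Fin.<? v
  ... | yes _ = inj₁ refl
  ... | no  _ = inj₂ refl

  sorted-comm : ∀ u v → sorted u v ≡ sorted v u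
  sorted-comm u v with u Fin.<? v | v Fin.<? u
  ... | yes u<v | yes v<u = contradiction v<u (ℕ.<-asym u<v)
  ... | yes _   | no _    = refl
  ... | no _    | yes _   = refl
  ... | no u≮v  | no v≮u  = cong₂ _,_ (sym u≡v) u≡v
    where u≡v = Fin.toℕ-injective (ℕ.≤-antisym (ℕ.≮⇒≥ v≮u) (ℕ.≮⇒≥ u≮v))

  -- The vertex is not one of those listed by S.
  _∉ᵛ_ : V → Vector V k → Set
  u ∉ᵛ S = ∀ z → u ≢ S z

  -- The degree of x in the graph with edge list E.
  edgeDegree : List (V × V) → V → ℕ
  edgeDegree E x = count (λ p → touches? x (List.lookup E p))

  module _ (χ : EdgeColouring G) (c : Colour) where
    open EdgeColouring χ

    module _ (n : Fin s → ℕ) (copy : MonochromaticCopy (starForest n) G χ c) where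
      open MonochromaticCopy copy
      private
        F : Fin s → Graph
        F a = K₁, n a

        vertex : Part F → V
        vertex = embed ∘ place F

        vertex-injective : Injective _≡_ _≡_ vertex
        vertex-injective = place-injective F ∘ injective

      -- With i counted from zero, the first i + 1 stars are disjoint, so i vertices
      -- cannot meet all of them.
      avoidingStar : (i : Fin s) (X : Fin (toℕ i) → V) →
                     ∃[ a ] a Fin.≤ i × (∀ v → vertex (a , v) ∉ᵛ X)
      avoidingStar i X = decide (Fin.all? (λ x → hit? (star x)))
        where
        Hit : Fin s → Set
        Hit a = ∃[ z ] ∃[ v ] vertex (a , v) ≡ X z
        hit? : ∀ a → Dec (Hit a)
        hit? a = Fin.any? (λ z → Fin.any? (λ v → vertex (a , v) Fin.≟ X z))
        star : Fin (suc (toℕ i)) → Fin s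
        star x = Fin.inject≤ x (Fin.toℕ<n i)
        decide : Dec (∀ x → Hit (star x)) → _
        decide (yes hits)
          with x , y , x<y , eq ← Fin.pigeonhole (ℕ.n<1+n (toℕ i)) (λ x → proj₁ (hits x))
          = contradiction x<y (ℕ.<-irrefl (cong toℕ
              (Fin.inject≤-injective (Fin.toℕ<n i) (Fin.toℕ<n i) x y
                (cong proj₁ (vertex-injective
                  (trans (proj₂ (proj₂ (hits x)))
                    (trans (cong X eq) (sym (proj₂ (proj₂ (hits y)))))))))))
        decide (no miss) with x , ¬hit ← Fin.¬∀⟶∃¬ _ _ (λ x → hit? (star x)) miss
          = star x ,
            subst (_≤ toℕ i) (sym (Fin.toℕ-inject≤ x (Fin.toℕ<n i))) (s≤s⁻¹ (Fin.toℕ<n x)) ,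
            λ v z eq → ¬hit (z , v , eq)

      -- The edges of star a are distinct members of the family E.
      starSize≤degree : (a : Fin s) (E : Vector (V × V) k) (class : Fin k → Colour) →
        (∀ b → ∃[ p ] class p ≡ c × E p ∼ (vertex (a , zero) , vertex (a , suc b))) →
        n a ≤ count (λ p → (class p ≟ᶜ c) ×-dec touches? (vertex (a , zero)) (E p))
      starSize≤degree a E class edgeOf = injection⇒≤count
        (λ p → (class p ≟ᶜ c) ×-dec touches? (vertex (a , zero)) (E p))
        (proj₁ ∘ edgeOf) distinct
        (λ b → proj₁ (proj₂ (edgeOf b)) ,
               Touches-resp-∼ (∼-sym (proj₂ (proj₂ (edgeOf b)))) (inj₁ refl))
        where
        leaf : Fin (n a) → V
        leaf b = vertex (a , suc b)
        leaf-injective : Injective _≡_ _≡_ leaf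
        leaf-injective {b} {b′} eq with refl ← vertex-injective {a , suc b} {a , suc b′} eq = refl
        otherEnd : ∀ {x y y′ : V} → (x , y) ∼ (x , y′) → y ≡ y′
        otherEnd (inj₁ refl) = refl
        otherEnd (inj₂ refl) = refl
        distinct : Injective _≡_ _≡_ (proj₁ ∘ edgeOf)
        distinct {b} {b′} eq = leaf-injective (otherEnd (∼-trans
          (∼-sym (proj₂ (proj₂ (edgeOf b))))
          (subst (λ p → E p ∼ (vertex (a , zero) , leaf b′)) (sym eq) (proj₂ (proj₂ (edgeOf b′))))))

      -- Suppose that every edge of colour c avoiding X occurs, with colour c, in the
      -- family E.  A copy of the forest has a star that avoids X and has at least n_i
      -- leaves, and hence gives a vertex of high degree in that class of E.
      forest⇒highDegree : Antitonic₁ Fin._≤_ _≤_ n →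
        (i : Fin s) (X : Fin (toℕ i) → V) (E : Vector (V × V) k) (class : Fin k → Colour) →
        (∀ {u v} (e : u ~ v) → colour e ≡ c → u ∉ᵛ X → v ∉ᵛ X →
         ∃[ p ] class p ≡ c × E p ∼ (u , v)) →
        ∃[ x ] n i ≤ count (λ p → (class p ≟ᶜ c) ×-dec touches? x (E p))
      forest⇒highDegree n-anti i X E class inClass
        with a , a≤i , avoids ← avoidingStar i X
        = vertex (a , zero) , ℕ.≤-trans (n-anti a≤i) (starSize≤degree a E class λ b →
            let e , coloured = edge (place-adjacent F a (root-leaf b))
            in inClass e coloured (avoids zero) (avoids (suc b)))

  -- All edges that avoid the vertices of S are listed in E.
  Covers : Vector V k → List (V × V) → Set
  Covers S E = ∀ {u v} → u ~ v → u ∉ᵛ S → v ∉ᵛ S → sorted u v ∈ E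

  Loopless : List (V × V) → Set
  Loopless E = ∀ {e} → e ∈ E → proj₁ e ≢ proj₂ e

  -- One of the vertices u and v is listed by X.
  Meets : Vector V k → V → V → Set
  Meets X u v = ∃[ z ] (u ≡ X z ⊎ v ≡ X z)

  meets? : (X : Vector V k) → ∀ u v → Dec (Meets X u v)
  meets? X u v = Fin.any? (λ z → (u Fin.≟ X z) ⊎-dec (v Fin.≟ X z))

  -- Red if P, else blue if Q, else the given colour.
  choose : {P Q : Set} → Dec P → Dec Q → Colour → Colour
  choose (yes _) _       c = red
  choose (no _)  (yes _) c = blue
  choose (no _)  (no _)  c = c

  choose-cong : {P P′ Q Q′ : Set} (p? : Dec P) (p′? : Dec P′) (q? : Dec Q) (q′? : Dec Q′) →
    (P → P′) → (P′ → P) → (Q → Q′) → (Q′ → Q) → ∀ c → choose p? q? c ≡ choose p′? q′? c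
  choose-cong (yes p) (yes _)  q?      q′?      f g h k c = refl
  choose-cong (yes p) (no ¬p′) q?      q′?      f g h k c = contradiction (f p) ¬p′
  choose-cong (no ¬p) (yes p′) q?      q′?      f g h k c = contradiction (g p′) ¬p
  choose-cong (no ¬p) (no _)   (yes q) (yes _)  f g h k c = refl
  choose-cong (no ¬p) (no _)   (yes q) (no ¬q′) f g h k c = contradiction (h q) ¬q′
  choose-cong (no ¬p) (no _)   (no ¬q) (yes q′) f g h k c = contradiction (k q′) ¬q
  choose-cong (no ¬p) (no _)   (no ¬q) (no _)   f g h k c = refl

  choose-red : {P Q : Set} (p? : Dec P) (q? : Dec Q) → ∀ c →
               choose p? q? c ≡ red → ¬ P → ¬ Q × c ≡ red
  choose-red (yes p) q?      c eq ¬p = contradiction p ¬p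
  choose-red (no _)  (no ¬q) c eq ¬p = ¬q , eq

  choose-blue : {P Q : Set} (p? : Dec P) (q? : Dec Q) → ∀ c →
                choose p? q? c ≡ blue → ¬ Q → ¬ P × c ≡ blue
  choose-blue (no _)  (yes q) c eq ¬q = contradiction q ¬q
  choose-blue (no ¬p) (no _)  c eq ¬q = ¬p , eq

  -- The colouring of the lower bound: edges that meet X are red, other edges that
  -- meet Y are blue, and the remaining edges, which all occur in E, have the
  -- colours prescribed by `class`.
  module SplitColouring {a b} (X : Vector V a) (Y : Vector V b)
    (E : List (V × V)) (class : Fin (length E) → Colour)
    (covers : ∀ {u v} → u ~ v → u ∉ᵛ X → v ∉ᵛ X → u ∉ᵛ Y → v ∉ᵛ Y → sorted u v ∈ E) where

    private
      Listed : V × V → Set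
      Listed e = ∃[ p ] List.lookup E p ≡ e

      listed? : ∀ e → Dec (Listed e)
      listed? e = Fin.any? (λ p → Product.≡-dec Fin._≟_ Fin._≟_ (List.lookup E p) e)

      -- Edges outside E meet X or Y, so the value red given to them is irrelevant.
      classOf : ∀ {e} → Dec (Listed e) → Colour
      classOf (yes (p , _)) = class p
      classOf (no _)        = red

      pairColour : V → V → Colour
      pairColour u v = choose (meets? X u v) (meets? Y u v) (classOf (listed? (sorted u v)))

      meets-swap : (Z : Vector V k) → ∀ {u v} → Meets Z u v → Meets Z v u
      meets-swap Z (z , h) = z , Sum.swap h

      pairColour-comm : ∀ u v → pairColour u v ≡ pairColour v u
      pairColour-comm u v = trans
        (choose-cong (meets? X u v) (meets? X v u) (meets? Y u v) (meets? Y v u)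
          (meets-swap X) (meets-swap X) (meets-swap Y) (meets-swap Y) _)
        (cong (λ e → choose (meets? X v u) (meets? Y v u) (classOf (listed? e))) (sorted-comm u v))

      ¬meets : (Z : Vector V k) → ∀ {u v} → u ∉ᵛ Z → v ∉ᵛ Z → ¬ Meets Z u v
      ¬meets Z u∉ v∉ (z , inj₁ eq) = u∉ z eq
      ¬meets Z u∉ v∉ (z , inj₂ eq) = v∉ z eq

      inClass : ∀ {e c} (d : Dec (Listed e)) → e ∈ E → classOf d ≡ c →
                ∃[ p ] class p ≡ c × List.lookup E p ≡ e
      inClass (yes (p , eq)) e∈E c≡ = p , c≡ , eq
      inClass (no ¬listed)   e∈E c≡ = contradiction (index e∈E , sym (lookup-index e∈E)) ¬listed

      inClass-∼ : ∀ {u v c} → u ~ v → u ∉ᵛ X → v ∉ᵛ X → u ∉ᵛ Y → v ∉ᵛ Y →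
                  classOf (listed? (sorted u v)) ≡ c → ∃[ p ] class p ≡ c × List.lookup E p ∼ (u , v)
      inClass-∼ {u} {v} e u∉X v∉X u∉Y v∉Y c≡
        with p , cp , eq ← inClass (listed? (sorted u v)) (covers e u∉X v∉X u∉Y v∉Y) c≡
        = p , cp , subst (_∼ (u , v)) (sym eq) (sorted-∼ u v)

    colouring : EdgeColouring G
    colouring = record
      { colour     = λ {u} {v} _ → pairColour u v
      ; undirected = λ {u} {v} _ _ → pairColour-comm u v
      }

    open EdgeColouring colouring

    red⇒class : ∀ {u v} (e : u ~ v) → colour e ≡ red → u ∉ᵛ X → v ∉ᵛ X →
                ∃[ p ] class p ≡ red × List.lookup E p ∼ (u , v)
    red⇒class {u} {v} e red≡ u∉X v∉X
      with ¬Y , c≡ ← choose-red (meets? X u v) (meets? Y u v) _ red≡ (¬meets X u∉X v∉X)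
      = inClass-∼ e u∉X v∉X (λ z eq → ¬Y (z , inj₁ eq)) (λ z eq → ¬Y (z , inj₂ eq)) c≡

    blue⇒class : ∀ {u v} (e : u ~ v) → colour e ≡ blue → u ∉ᵛ Y → v ∉ᵛ Y →
                 ∃[ p ] class p ≡ blue × List.lookup E p ∼ (u , v)
    blue⇒class {u} {v} e blue≡ u∉Y v∉Y
      with ¬X , c≡ ← choose-blue (meets? X u v) (meets? Y u v) _ blue≡ (¬meets Y u∉Y v∉Y)
      = inClass-∼ e (λ z eq → ¬X (z , inj₁ eq)) (λ z eq → ¬X (z , inj₂ eq)) u∉Y v∉Y c≡

  module _ {s t} {n : Fin s → ℕ} {m : Fin t → ℕ}
    (n-anti : Antitonic₁ Fin._≤_ _≤_ n) (m-anti : Antitonic₁ Fin._≤_ _≤_ m)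
    (n-odd : ∀ i → parity (n i) ≡ 1ℙ) (m-odd : ∀ j → parity (m j) ≡ 1ℙ) where

    -- With indices counted from zero, S lists i + j deleted vertices: the first i of
    -- them form X and the last j form Y.
    split⇒¬arrow : (i : Fin s) (j : Fin t) (S : Fin (toℕ i + toℕ j) → V) (E : List (V × V)) →
      Covers S E → (class : Fin (length E) → Colour) →
      (∀ x → count (λ p → (class p ≟ᶜ red)  ×-dec touches? x (List.lookup E p)) < n i) →
      (∀ x → count (λ p → (class p ≟ᶜ blue) ×-dec touches? x (List.lookup E p)) < m j) →
      ¬ (G ⟶⟨ starForest n , starForest m ⟩)
    split⇒¬arrow i j S E covers class redSmall blueSmall arrow = neither (arrow colouring)
      where
      X : Vector V (toℕ i)
      X z = S (z ↑ˡ toℕ j)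
      Y : Vector V (toℕ j)
      Y z = S (toℕ i ↑ʳ z)
      outside : ∀ {u} → u ∉ᵛ X → u ∉ᵛ Y → u ∉ᵛ S
      outside u∉X u∉Y z eq with splitAt (toℕ i) z in at
      ... | inj₁ z′ = u∉X z′ (trans eq (cong S (sym (Fin.splitAt⁻¹-↑ˡ at))))
      ... | inj₂ z′ = u∉Y z′ (trans eq (cong S (sym (Fin.splitAt⁻¹-↑ʳ at))))
      open SplitColouring X Y E class
        (λ e u∉X v∉X u∉Y v∉Y → covers e (outside u∉X u∉Y) (outside v∉X v∉Y))
      neither : ¬ (MonochromaticCopy (starForest n) G colouring red ⊎
                   MonochromaticCopy (starForest m) G colouring blue)
      neither (inj₁ copy) =
        let x , large = forest⇒highDegree colouring red n copy n-anti i X (List.lookup E) class red⇒class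
        in ℕ.<⇒≱ (redSmall x) large
      neither (inj₂ copy) =
        let x , large = forest⇒highDegree colouring blue m copy m-anti j Y (List.lookup E) class blue⇒class
        in ℕ.<⇒≱ (blueSmall x) large

    -- If all degrees were smaller, they would be at most n_i + m_j - 2 = 2(a + b)
    -- for n_i = 2a + 1 and m_j = 2b + 1.
    highDegree : G ⟶⟨ starForest n , starForest m ⟩ →
      (i : Fin s) (j : Fin t) (S : Fin (toℕ i + toℕ j) → V) (E : List (V × V)) →
      Loopless E → Covers S E → ∃[ x ] n i + m j ∸ 1 ≤ edgeDegree E x
    highDegree arrow i j S E loopless covers
      with Fin.any? (λ x → n i + m j ∸ 1 ℕ.≤? edgeDegree E x)
    ... | yes high = high
    ... | no  low  = contradiction arrow (split⇒¬arrow i j S E covers (proj₁ split)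
            (λ x → ℕ.≤-trans (s≤s (proj₁ (proj₂ split x))) (ℕ.≤-reflexive (sym n≡)))
            (λ x → ℕ.≤-trans (s≤s (proj₂ (proj₂ split x))) (ℕ.≤-reflexive (sym m≡))))
      where
      a  = proj₁ (odd (n i) (n-odd i))
      n≡ = proj₂ (odd (n i) (n-odd i))
      b  = proj₁ (odd (m j) (m-odd j))
      m≡ = proj₂ (odd (m j) (m-odd j))
      sumOfOdds : ∀ {x y a b} → x ≡ suc (a + a) → y ≡ suc (b + b) →
                  x + y ∸ 1 ≡ suc ((a + b) + (a + b))
      sumOfOdds {a = a} {b = b} refl refl = trans (ℕ.+-suc (a + a) (b + b)) (cong suc (lemma a b))
        where
        lemma : ∀ a b → (a + a) + (b + b) ≡ (a + b) + (a + b)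
        lemma = solve-∀
      split = twoFactorSplit a b (List.lookup E) (λ p → loopless (∈-lookup p))
        (λ x → s≤s⁻¹ (subst (edgeDegree E x <_) (sumOfOdds {a = a} {b = b} n≡ m≡)
                             (ℕ.≰⇒> (λ h → low (x , h)))))

    -- The deletions start at k = 2: when the d vertices of S have been deleted, the
    -- next value of k is d + 2, and p values of k are left, listed by g.
    peel : .{{_ : NonZero s}} .{{_ : NonZero t}} → G ⟶⟨ starForest n , starForest m ⟩ →
           ∀ p d → d + p ≡ s + t ∸ 1 → (S : Vector V d) (E : List (V × V)) →
           Loopless E → Covers S E → (g : ℕ → ℕ) → (∀ r → g r ≡ 2 + (d + r)) →
           sumList (map (l n m) (applyUpTo g p)) ≤ length E
    peel arrow zero    d eq S E loopless covers g g≡ = z≤n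
    peel arrow (suc p) d eq S E loopless covers g g≡
      with i₀ , j₀ , ij₀ ← indexPair s t (subst (d <_) eq (ℕ.m<m+n d (s≤s z≤n)))
      with i , j , refl , l≡ ← l-attained n m d i₀ j₀ ij₀
      with x , high ← highDegree arrow i j S E loopless covers
      = begin
        l n m (g 0) + sumList (map (l n m) (applyUpTo (g ∘ suc) p))
          ≤⟨ ℕ.+-mono-≤ (ℕ.≤-trans (ℕ.≤-reflexive (trans (cong (l n m) g0≡) l≡)) high)
               (peel arrow p (suc d) (trans (sym (ℕ.+-suc d p)) eq) (x Vector.∷ S) (rest x)
                 (λ e∈ → loopless (proj₁ (∈-filter⁻ (λ e → ¬? (touches? x e)) e∈)))
                 (covers′ x) (g ∘ suc) (λ r → trans (g≡ (suc r)) (cong (2 +_) (ℕ.+-suc d r)))) ⟩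
        edgeDegree E x + length (rest x) ≡⟨ length-filter (touches? x) E ⟨
        length E ∎
      where
      open ℕ.≤-Reasoning
      g0≡ : g 0 ≡ 2 + d
      g0≡ = trans (g≡ 0) (cong (2 +_) (ℕ.+-identityʳ d))
      rest : V → List (V × V)
      rest x = filter (λ e → ¬? (touches? x e)) E
      covers′ : ∀ x → Covers (x Vector.∷ S) (rest x)
      covers′ x {u} {v} e u∉ v∉ = ∈-filter⁺ (λ e → ¬? (touches? x e))
        (covers e (u∉ ∘ suc) (v∉ ∘ suc))
        (λ touches → untouched (Touches-resp-∼ (sorted-∼ u v) touches))
        where
        untouched : ¬ Touches x (u , v)
        untouched (inj₁ eq) = u∉ zero eq
        untouched (inj₂ eq) = v∉ zero eq

    lowerBound : .{{_ : NonZero s}} .{{_ : NonZero t}} → G ⟶⟨ starForest n , starForest m ⟩ →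
                 sumFrom2To (s + t) (l n m) ≤ size
    lowerBound arrow = peel arrow (s + t ∸ 1) 0 refl (λ ()) edges loopless covers (2 +_) (λ r → refl)
      where
      edge? : ∀ e → Dec (proj₁ e Fin.< proj₂ e × proj₁ e ~ proj₂ e)
      edge? (u , v) = (u Fin.<? v) ×-dec (u ~? v)
      loopless : Loopless edges
      loopless e∈ eq = ~-irrefl eq (proj₂ (proj₂
        (∈-filter⁻ edge? {xs = cartesianProduct (allFin order) (allFin order)} e∈)))
      covers : Covers (λ ()) edges
      covers {u} {v} e _ _ with u Fin.<? v
      ... | yes u<v = ∈-filter⁺ edge? (∈-cartesianProduct⁺ (∈-allFin u) (∈-allFin v)) (u<v , e)
      ... | no u≮v  = ∈-filter⁺ edge? (∈-cartesianProduct⁺ (∈-allFin v) (∈-allFin u))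
        (ℕ.≤∧≢⇒< (ℕ.≮⇒≥ u≮v) (λ eq → ~-irrefl (sym (Fin.toℕ-injective eq)) e) , ~-sym e)

theorem2p5 : (s t : ℕ) .{{_ : NonZero s}} .{{_ : NonZero t}}
    (n : Fin s → ℕ) (m : Fin t → ℕ) →
    Antitonic₁ Fin._≤_ _≤_ n →
    Antitonic₁ Fin._≤_ _≤_ m →
    (∀ i → parity (n i) ≡ 1ℙ) →
    (∀ j → parity (m j) ≡ 1ℙ) →
    IsSizeRamseyNumber
    (⨆ (λ i → K₁, (n i)))
    (⨆ (λ j → K₁, (m j)))
    (sumFrom2To (s + t) (l n m))
theorem2p5 s t n m n-anti m-anti n-odd m-odd = record
  { attained = starForest L , noIsolated positive , arrows n-anti m-anti , size-forest
  ; minimal  = λ G _ arrow → LowerBound.lowerBound G n-anti m-anti n-odd m-odd arrow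
  }
  where
  open Upper s t n m
  positive : ∀ i j → 1 ≤ n i + m j ∸ 1
  positive i j with a , n≡ ← odd (n i) (n-odd i) | b , m≡ ← odd (m j) (m-odd j)
    rewrite n≡ | m≡ = ℕ.≤-trans (s≤s z≤n) (ℕ.m≤n+m _ (a + a))
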